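{- Let $G$ be a topological group, let $\mathfrak M$ be an I-finite $G$-Mackey system and let $\mathcal U$ be a descent basis for $\mathfrak M$. The following holds: (i) The adjunction $(\varepsilon,\eta):(-)^*_{\mathcal U}\dashv(-)_*$ induces an equivalence between the full subcategory of ${}_G\mathsf{Ab}^{\mathrm d}$ consisting of all $A$ with $A=\bigcup_{U\in\mathcal U}A^U$ and the category $\mathsf{Mack}^{\mathcal U\text{ - }\mathrm{Gal}}(\mathfrak M,\mathsf{Ab})$. (ii) If $\mathcal U$ is a neighborhood basis of $1\in G$, then $(\varepsilon,\eta):(-)^*_{\mathcal U}\dashv(-)_*$ induces an equivalence between ${}_G\mathsf{Ab}^{\mathrm d}$ and $\mathsf{Mack}^{\mathcal U\text{ - }\mathrm{Gal}}(\mathfrak M,\mathsf{Ab})$.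
   Context: ${}_G\mathsf{Ab}^{\mathrm d}$ is the category of discrete $G$-modules. ${}^gH=gHg^{ -1}$, $H^g=g^{ -1}Hg$. A $G$-subgroup system $\mathfrak S=(\mathfrak S_{\mathrm b},\mathfrak S_{\mathrm r},\mathfrak S_{\mathrm i})$ consists of a non-empty set $\mathfrak S_{\mathrm b}$ of subgroups of $G$ closed under conjugation and, for each $H\in\mathfrak S_{\mathrm b}$ and $\star\in\{\mathrm r,\mathrm i\}$, a set $\mathfrak S_\star(H)\subseteq\{I\in\mathfrak S_{\mathrm b}:I\le H\}$ with $H\in\mathfrak S_\star(H)$; $I\in\mathfrak S_\star(H)\Rightarrow\mathfrak S_\star(I)\subseteq\mathfrak S_\star(H)$; ${}^g\mathfrak S_\star(H)=\mathfrak S_\star({}^gH)$. It is I-finite if $[H:I]<\infty$ for $I\in\mathfrak S_{\mathrm i}(H)$. It is a $G$-Mackey system if for $I\in\mathfrak S_{\mathrm r}(H)$, $J\in\mathfrak S_{\mathrm i}(H)$ the set $I\backslash H/J$ is finite, $I\cap J\in\mathfrak S_{\mathrm r}(J)$ and $I\cap J\in\mathfrak S_{\mathrm i}(I)$. A Mackey functor $\Phi:\mathfrak M\to\mathsf{Ab}$ consists of abelian groups $\Phi(H)$ ($H\in\mathfrak M_{\mathrm b}$) and homomorphisms $\mathrm{res}_{I,H}:\Phi(H)\to\Phi(I)$ ($I\in\mathfrak M_{\mathrm r}(H)$), $\mathrm{ind}_{H,I}:\Phi(I)\to\Phi(H)$ ($I\in\mathfrak M_{\mathrm i}(H)$), $\mathrm{con}_{g,H}:\Phi(H)\to\Phi({}^gH)$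 ($g\in G$) with: $\mathrm{res}_{H,H}=\mathrm{ind}_{H,H}=\mathrm{id}$, $\mathrm{con}_{h,H}=\mathrm{id}$ for $h\in H$; $\mathrm{res}_{J,I}\mathrm{res}_{I,H}=\mathrm{res}_{J,H}$, $\mathrm{ind}_{H,I}\mathrm{ind}_{I,J}=\mathrm{ind}_{H,J}$, $\mathrm{con}_{g',{}^gH}\mathrm{con}_{g,H}=\mathrm{con}_{g'g,H}$; $\mathrm{con}_{g,I}\mathrm{res}_{I,H}=\mathrm{res}_{{}^gI,{}^gH}\mathrm{con}_{g,H}$, $\mathrm{con}_{g,H}\mathrm{ind}_{H,I}=\mathrm{ind}_{{}^gH,{}^gI}\mathrm{con}_{g,I}$; and $\mathrm{res}_{I,H}\mathrm{ind}_{H,J}=\sum_{h}\mathrm{ind}_{I,I\cap{}^hJ}\,\mathrm{con}_{h,I^h\cap J}\,\mathrm{res}_{I^h\cap J,J}$ ($h$ over representatives of $I\backslash H/J$) for $I\in\mathfrak M_{\mathrm r}(H)$, $J\in\mathfrak M_{\mathrm i}(H)$. Morphisms are families of homomorphisms commuting with res, ind, con; the category is $\mathsf{Mack}(\mathfrak M,\mathsf{Ab})$. A descent basis for $\mathfrak M$ is a subset $\mathcal U\subseteq\mathfrak M_{\mathrm b}$ of open normal subgroups of $G$ which is a filter basis on $G$ (non-empty, and any two members contain a third in their intersection) such that $\mathcal U(H):=\{U\in\mathcal U:U\le H\}\subseteq\mathfrak M_{\mathrm r}(H)$ and $\mathcal U(H)\ne\emptyset$ for each $H\in\mathfrak M_{\mathrm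 b}$. $(-)_*:{}_G\mathsf{Ab}^{\mathrm d}\to\mathsf{Mack}(\mathfrak M,\mathsf{Ab})$: $A_*(H)=A^H$, res = inclusion, $\mathrm{ind}_{H,I}(a)=\sum_{h\in H/I}ha$, $\mathrm{con}_{g,H}(a)=ga$. $(-)^*_{\mathcal U}:\mathsf{Mack}(\mathfrak M,\mathsf{Ab})\to{}_G\mathsf{Ab}^{\mathrm d}$: $\Phi^*_{\mathcal U}=\mathrm{colim}_{U\in(\mathcal U,\supseteq)}\Phi(U)$ along restrictions, $g[U,a]=[U,\mathrm{con}_{g,U}(a)]$, where $[U,a]$ is the class of $a\in\Phi(U)$. The functor $(-)^*_{\mathcal U}$ is left adjoint to $(-)_*$ with counit $\varepsilon(A):(A_*)^*_{\mathcal U}\to A$, $[U,a]\mapsto a$, and unit $\eta(\Phi)_H:\Phi(H)\to(\Phi^*_{\mathcal U})^H$, $a\mapsto[U,\mathrm{res}_{U,H}(a)]$ for any $U\in\mathcal U(H)$. For $U\in\mathcal U(H)$ the group $H/U$ acts on $\Phi(U)$ via con. $\Phi\in\mathsf{Mack}(\mathfrak M,\mathsf{Ab})$ has $\mathcal U$-Galois descent if $\mathrm{res}_{U,H}:\Phi(H)\to\Phi(U)^{H/U}$ is an isomorphism for all $H\in\mathfrak M_{\mathrm b}$ and $U\in\mathcal U(H)$; $\mathsf{Mack}^{\mathcal U\text{ - }\mathrm{Gal}}(\mathfrak M,\mathsf{Ab})$ is the full subcategory of such $\Phi$. -}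

module Defs where

open import Level using (Level; _⊔_) renaming (suc to lsuc)
open import Algebra.Bundles using (Group; AbelianGroup)
open import Algebra.Morphism.Bundles using (GroupHomomorphism)
open import Algebra.Morphism.Structures using (module GroupMorphisms)
import Algebra.Properties.Group as GroupProperties
import Algebra.Properties.CommutativeMonoid.Sum as CommutativeMonoidSum
open import Data.Fin.Base using (Fin; zero; suc; splitAt; _↑ˡ_; _↑ʳ_)
open import Data.Fin.Properties using (+↔⊎; splitAt-↑ˡ; splitAt-↑ʳ)
open import Data.Nat.Base as ℕ using (ℕ)
open import Data.Product.Base using (Σ; ∃; _×_; _,_; proj₁; proj₂; uncurry)
open import Data.Sum.Base using (_⊎_; inj₁; inj₂)
open import Data.Sum.Function.Propositional using (_⊎-↔_)
open import Data.Unit.Polymorphic.Base using (⊤)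
open import Function.Base using (_∘_; id)
open import Function.Bundles using (Inverse; _↔_; mk↔ₛ′)
open import Function.Construct.Identity using (↔-id)
open import Function.Construct.Composition using (_↔-∘_)
open import Relation.Binary.Bundles using (Setoid)
open import Relation.Binary.PropositionalEquality as ≡ using (_≡_)
import Relation.Binary.Reasoning.Setoid as SetoidReasoning
open import Relation.Binary.Structures using (IsEquivalence)
open import Relation.Unary using (Pred; _∈_; _⊆_; _≐_; _∩_; ⋃)

record Category (o h e : Level) : Set (lsuc (o ⊔ h ⊔ e)) where
  infix  4 _≈_
  infixr 9 _∙_
  field
    Obj       : Set o
    Hom       : Obj → Obj → Set h
    _≈_       : ∀ {A B} → Hom A B → Hom A B → Set e
    idₘ       : ∀ {A} → Hom A A
    _∙_       : ∀ {A B C} → Hom B C → Hom A B → Hom A C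
    isEquiv   : ∀ {A B} → IsEquivalence (_≈_ {A} {B})
    ∙-cong    : ∀ {A B C} {f f′ : Hom B C} {g g′ : Hom A B} → f ≈ f′ → g ≈ g′ → f ∙ g ≈ f′ ∙ g′
    identityˡ : ∀ {A B} {f : Hom A B} → idₘ ∙ f ≈ f
    identityʳ : ∀ {A B} {f : Hom A B} → f ∙ idₘ ≈ f
    assoc     : ∀ {A B C D} {f : Hom C D} {g : Hom B C} {k : Hom A B} → (f ∙ g) ∙ k ≈ f ∙ (g ∙ k)

record IsIso {o h e} (C : Category o h e) {A B : Category.Obj C} (f : Category.Hom C A B) : Set (h ⊔ e) where
  open Category C
  field
    inverse  : Hom B A
    inverseˡ : inverse ∙ f ≈ idₘ
    inverseʳ : f ∙ inverse ≈ idₘ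

record Functor {o h e o′ h′ e′} (C : Category o h e) (D : Category o′ h′ e′) : Set (o ⊔ h ⊔ e ⊔ o′ ⊔ h′ ⊔ e′) where
  private
    module C = Category C
    module D = Category D
  field
    F₀     : C.Obj → D.Obj
    F₁     : ∀ {A B} → C.Hom A B → D.Hom (F₀ A) (F₀ B)
    F-cong : ∀ {A B} {f g : C.Hom A B} → f C.≈ g → F₁ f D.≈ F₁ g
    F-id   : ∀ {A} → F₁ (C.idₘ {A}) D.≈ D.idₘ
    F-∙    : ∀ {A B E} {f : C.Hom B E} {g : C.Hom A B} → F₁ (f C.∙ g) D.≈ F₁ f D.∙ F₁ g

record Adjunction {o h e o′ h′ e′} {C : Category o h e} {D : Category o′ h′ e′}
                  (L : Functor D C) (R : Functor C D) : Set (o ⊔ h ⊔ e ⊔ o′ ⊔ h′ ⊔ e′) where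
  private
    module C = Category C
    module D = Category D
    module L = Functor L
    module R = Functor R
  field
    unit           : ∀ X → D.Hom X (R.F₀ (L.F₀ X))
    counit         : ∀ A → C.Hom (L.F₀ (R.F₀ A)) A
    unit-natural   : ∀ {X Y} (f : D.Hom X Y) → unit Y D.∙ f D.≈ R.F₁ (L.F₁ f) D.∙ unit X
    counit-natural : ∀ {A B} (f : C.Hom A B) → counit B C.∙ L.F₁ (R.F₁ f) C.≈ f C.∙ counit A
    zig            : ∀ {X} → counit (L.F₀ X) C.∙ L.F₁ (unit X) C.≈ C.idₘ
    zag            : ∀ {A} → R.F₁ (counit A) D.∙ unit (R.F₀ A) D.≈ D.idₘ

IsAdjointEquivalence : ∀ {o h e o′ h′ e′} {C : Category o h e} {D : Category o′ h′ e′}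
                       {L : Functor D C} {R : Functor C D} → Adjunction L R → Set (o ⊔ h ⊔ e ⊔ o′ ⊔ h′ ⊔ e′)
IsAdjointEquivalence {C = C} {D} adj = (∀ X → IsIso D (unit X)) × (∀ A → IsIso C (counit A))
  where open Adjunction adj

FullSubcategory : ∀ {o h e p} (C : Category o h e) → Pred (Category.Obj C) p → Category (o ⊔ p) h e
FullSubcategory C P = record
  { Obj       = Σ C.Obj P
  ; Hom       = λ A B → C.Hom (proj₁ A) (proj₁ B)
  ; _≈_       = C._≈_
  ; idₘ       = C.idₘ
  ; _∙_       = C._∙_
  ; isEquiv   = C.isEquiv
  ; ∙-cong    = C.∙-cong
  ; identityˡ = C.identityˡ
  ; identityʳ = C.identityʳ
  ; assoc     = C.assoc
  } where module C = Category C

module _ {o h e o′ h′ e′} {C : Category o h e} {D : Category o′ h′ e′} where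

  restrictFunctor : ∀ {p q} {P : Pred (Category.Obj C) p} {Q : Pred (Category.Obj D) q} (F : Functor C D) →
                    (∀ A → P A → Q (Functor.F₀ F A)) → Functor (FullSubcategory C P) (FullSubcategory D Q)
  restrictFunctor F F-P⊆Q = record
    { F₀     = λ A → F₀ (proj₁ A) , F-P⊆Q (proj₁ A) (proj₂ A)
    ; F₁     = F₁
    ; F-cong = F-cong
    ; F-id   = F-id
    ; F-∙    = F-∙
    } where open Functor F

  restrictDomain : ∀ {p} {P : Pred (Category.Obj C) p} → Functor C D → Functor (FullSubcategory C P) D
  restrictDomain F = record
    { F₀     = F₀ ∘ proj₁
    ; F₁     = F₁
    ; F-cong = F-cong
    ; F-id   = F-id
    ; F-∙    = F-∙
    } where open Functor F

  restrictCodomain : ∀ {q} {Q : Pred (Category.Obj D) q} (F : Functor C D) →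
                     (∀ A → Q (Functor.F₀ F A)) → Functor C (FullSubcategory D Q)
  restrictCodomain F F-Q = record
    { F₀     = λ A → F₀ A , F-Q A
    ; F₁     = F₁
    ; F-cong = F-cong
    ; F-id   = F-id
    ; F-∙    = F-∙
    } where open Functor F

module _ {o h e o′ h′ e′} {C : Category o h e} {D : Category o′ h′ e′}
         {L : Functor D C} {R : Functor C D} (adj : Adjunction L R) where
  private
    module L = Functor L
    module R = Functor R
  open Adjunction adj

  restrictAdjunction : ∀ {p q} {P : Pred (Category.Obj C) p} {Q : Pred (Category.Obj D) q}
                       (L-Q⊆P : ∀ X → Q X → P (L.F₀ X)) (R-P⊆Q : ∀ A → P A → Q (R.F₀ A)) →
                       Adjunction (restrictFunctor {P = Q} {Q = P} L L-Q⊆P) (restrictFunctor {P = P} {Q = Q} R R-P⊆Q)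
  restrictAdjunction L-Q⊆P R-P⊆Q = record
    { unit           = λ X → unit (proj₁ X)
    ; counit         = λ A → counit (proj₁ A)
    ; unit-natural   = unit-natural
    ; counit-natural = counit-natural
    ; zig            = zig
    ; zag            = zag
    }

  restrictAdjunctionˡ : ∀ {q} {Q : Pred (Category.Obj D) q} (R-Q : ∀ A → Q (R.F₀ A)) →
                        Adjunction (restrictDomain {P = Q} L) (restrictCodomain {Q = Q} R R-Q)
  restrictAdjunctionˡ R-Q = record
    { unit           = λ X → unit (proj₁ X)
    ; counit         = counit
    ; unit-natural   = unit-natural
    ; counit-natural = counit-natural
    ; zig            = zig
    ; zag            = zag
    }

  -- L and R map the full subcategories Q ⊆ D and P ⊆ C into each other, and the
  -- restricted unit and counit are isomorphisms.
  InducesEquivalence : ∀ {p q} → Pred (Category.Obj C) p → Pred (Category.Obj D) q →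
                       Set (o ⊔ h ⊔ e ⊔ o′ ⊔ h′ ⊔ e′ ⊔ p ⊔ q)
  InducesEquivalence P Q =
    Σ (∀ X → Q X → P (L.F₀ X)) λ L-Q⊆P →
    Σ (∀ A → P A → Q (R.F₀ A)) λ R-P⊆Q →
    IsAdjointEquivalence (restrictAdjunction {P = P} {Q = Q} L-Q⊆P R-P⊆Q)

  -- The case where P is all of C.
  InducesEquivalenceˡ : ∀ {q} → Pred (Category.Obj D) q → Set (o ⊔ h ⊔ e ⊔ o′ ⊔ h′ ⊔ e′ ⊔ q)
  InducesEquivalenceˡ Q =
    Σ (∀ A → Q (R.F₀ A)) λ R-Q → IsAdjointEquivalence (restrictAdjunctionˡ {Q = Q} R-Q)

-- A finite setoid comes with an enumeration; a finite set of cosets thus comes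
-- with a system of representatives.
Finite : ∀ {a b} → Setoid a b → Set (a ⊔ b)
Finite S = ∃ λ n → Inverse (≡.setoid (Fin n)) S

glue : ∀ {d} (n : Fin (ℕ.suc d) → ℕ) → (Fin (n zero) ⊎ Σ (Fin d) (Fin ∘ n ∘ suc)) ↔ Σ (Fin (ℕ.suc d)) (Fin ∘ n)
glue n = mk↔ₛ′ (λ { (inj₁ x) → zero , x ; (inj₂ (k , x)) → suc k , x })
               (λ { (zero , x) → inj₁ x ; (suc k , x) → inj₂ (k , x) })
               (λ { (zero , x) → ≡.refl ; (suc k , x) → ≡.refl })
               (λ { (inj₁ x) → ≡.refl ; (inj₂ (k , x)) → ≡.refl })

finiteΣ : ∀ {d} (n : Fin d → ℕ) → Finite (≡.setoid (Σ (Fin d) (Fin ∘ n)))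
finiteΣ {ℕ.zero}  n = 0 , mk↔ₛ′ (λ ()) (λ { (() , _) }) (λ { (() , _) }) (λ ())
finiteΣ {ℕ.suc d} n = n zero ℕ.+ proj₁ rest , glue n ↔-∘ ((↔-id (Fin (n zero)) ⊎-↔ proj₂ rest) ↔-∘ +↔⊎)
  where
  rest : Finite (≡.setoid (Σ (Fin d) (Fin ∘ n ∘ suc)))
  rest = finiteΣ (n ∘ suc)

module FiniteSum {a b} (A : AbelianGroup a b) where
  open AbelianGroup A
  open CommutativeMonoidSum commutativeMonoid public using (sum; sum-cong-≋; sum-permute; ∑-distrib-+)

  sumOver : ∀ {s t} {S : Setoid s t} → Finite S → (Setoid.Carrier S → Carrier) → Carrier
  sumOver (n , e) f = sum {n} (f ∘ Inverse.to e)

  sum-cong : ∀ {n} {f g : Fin n → Carrier} → (∀ k → f k ≈ g k) → sum f ≈ sum g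
  sum-cong = sum-cong-≋

  sum-bijection : ∀ {s t s′ t′} {S : Setoid s t} {S′ : Setoid s′ t′} (E : Finite S) (E′ : Finite S′)
                  (let module S = Setoid S) (let module S′ = Setoid S′) (φ : S.Carrier → S′.Carrier) →
                  (∀ {x y} → x S.≈ y → φ x S′.≈ φ y) → (∀ {x y} → φ x S′.≈ φ y → x S.≈ y) →
                  (∀ z → ∃ λ x → φ x S′.≈ z) →
                  (f : S.Carrier → Carrier) (f′ : S′.Carrier → Carrier) →
                  (∀ {x y} → x S′.≈ y → f′ x ≈ f′ y) → (∀ x → f x ≈ f′ (φ x)) →
                  sumOver E f ≈ sumOver E′ f′
  sum-bijection {S = S} {S′} (n , e) (n′ , e′) φ φ-cong φ-inj φ-surj f f′ f′-cong f≈f′φ =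
    trans (sum-cong (λ k → trans (f≈f′φ (E.to k)) (f′-cong (S′.sym (E′.strictlyInverseˡ (φ (E.to k)))))))
          (sym (sum-permute (f′ ∘ E′.to) (mk↔ₛ′ to from to-from from-to)))
    where
    module S = Setoid S
    module S′ = Setoid S′
    module E = Inverse e
    module E′ = Inverse e′
    to : Fin n → Fin n′
    to k = E′.from (φ (E.to k))
    from : Fin n′ → Fin n
    from k = E.from (proj₁ (φ-surj (E′.to k)))
    to-from : ∀ k → to (from k) ≡ k
    to-from k = ≡.trans (E′.from-cong (S′.trans (φ-cong (E.strictlyInverseˡ _)) (proj₂ (φ-surj (E′.to k)))))
                        (E′.strictlyInverseʳ k)
    from-to : ∀ k → from (to k) ≡ k
    from-to k = ≡.trans (E.from-cong (φ-inj (S′.trans (proj₂ (φ-surj (E′.to (to k)))) (E′.strictlyInverseˡ _))))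
                        (E.strictlyInverseʳ k)

  sum-++ : ∀ m {n} (f : Fin (m ℕ.+ n) → Carrier) → sum f ≈ sum (f ∘ (_↑ˡ n)) ∙ sum (f ∘ (m ↑ʳ_))
  sum-++ ℕ.zero    f = sym (identityˡ _)
  sum-++ (ℕ.suc m) f = trans (∙-congˡ (sum-++ m (f ∘ suc))) (sym (assoc _ _ _))

  sum-Σ : ∀ {d} (n : Fin d → ℕ) (f : Σ (Fin d) (Fin ∘ n) → Carrier) →
          sumOver (finiteΣ n) f ≈ sum (λ k → sum (λ x → f (k , x)))
  sum-Σ {ℕ.zero}  n f = refl
  sum-Σ {ℕ.suc d} n f = trans (sum-++ (n zero) _) (∙-cong
    (sum-cong (λ x → reflexive (≡.cong (f ∘ step) (splitAt-↑ˡ (n zero) x _))))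
    (trans (sum-cong (λ y → reflexive (≡.cong (f ∘ step) (splitAt-↑ʳ (n zero) _ y))))
           (sum-Σ (n ∘ suc) (λ { (k , x) → f (suc k , x) }))))
    where
    step : Fin (n zero) ⊎ Fin (proj₁ (finiteΣ (n ∘ suc))) → Σ (Fin (ℕ.suc d)) (Fin ∘ n)
    step = Inverse.to (glue n) ∘ Inverse.to (↔-id (Fin (n zero)) ⊎-↔ proj₂ (finiteΣ (n ∘ suc)))

  sum-fibres : ∀ {s t} {S : Setoid s t} (E : Finite S) (let module S = Setoid S)
               {d} (n : Fin d → ℕ) (φ : ∀ k → Fin (n k) → S.Carrier) →
               (∀ {k k′ x x′} → φ k x S.≈ φ k′ x′ → (k , x) ≡ (k′ , x′)) →
               (∀ z → ∃ λ k → ∃ λ x → φ k x S.≈ z) →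
               (f : S.Carrier → Carrier) → (∀ {x y} → x S.≈ y → f x ≈ f y) →
               sumOver E f ≈ sum (λ k → sum (λ x → f (φ k x)))
  sum-fibres {S = S} E n φ φ-inj φ-surj f f-cong = trans
    (sym (sum-bijection (finiteΣ n) E (uncurry φ) (λ { ≡.refl → Setoid.refl S }) φ-inj
           (λ z → let (k , x , eq) = φ-surj z in (k , x) , eq) (f ∘ uncurry φ) f f-cong (λ _ → refl)))
    (sum-Σ n _)

AbHom : ∀ {a b c d} → AbelianGroup a b → AbelianGroup c d → Set (a ⊔ b ⊔ c ⊔ d)
AbHom A B = GroupHomomorphism (AbelianGroup.rawGroup A) (AbelianGroup.rawGroup B)

module _ {a b c d} {A : AbelianGroup a b} {B : AbelianGroup c d} where
  private
    module A = AbelianGroup A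
    module B = AbelianGroup B
  open GroupProperties B.group using (identityˡ-unique; inverseˡ-unique)

  abstract
    preserves-ε : (f : A.Carrier → B.Carrier) → (∀ {x y} → x A.≈ y → f x B.≈ f y) →
                  (∀ x y → f (x A.∙ y) B.≈ f x B.∙ f y) → f A.ε B.≈ B.ε
    preserves-ε f f-cong f-homo = identityˡ-unique _ _ (B.trans (B.sym (f-homo _ _)) (f-cong (A.identityˡ A.ε)))

    preserves-⁻¹ : (f : A.Carrier → B.Carrier) → (∀ {x y} → x A.≈ y → f x B.≈ f y) →
                   (∀ x y → f (x A.∙ y) B.≈ f x B.∙ f y) → ∀ x → f (x A.⁻¹) B.≈ f x B.⁻¹
    preserves-⁻¹ f f-cong f-homo x = inverseˡ-unique _ _
      (B.trans (B.sym (f-homo _ _)) (B.trans (f-cong (A.inverseˡ x)) (preserves-ε f f-cong f-homo)))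

  mkHom : (f : A.Carrier → B.Carrier) → (∀ {x y} → x A.≈ y → f x B.≈ f y) →
          (∀ x y → f (x A.∙ y) B.≈ f x B.∙ f y) → AbHom A B
  mkHom f f-cong f-homo .GroupHomomorphism.⟦_⟧ = f
  mkHom f f-cong f-homo .GroupHomomorphism.isGroupHomomorphism = record
    { isMonoidHomomorphism = record
      { isMagmaHomomorphism = record { isRelHomomorphism = record { cong = f-cong } ; homo = f-homo }
      ; ε-homo = preserves-ε f f-cong f-homo
      }
    ; ⁻¹-homo = preserves-⁻¹ f f-cong f-homo
    }

module _ {a b c d} {A : AbelianGroup a b} {B : AbelianGroup c d} (f : AbHom A B) where
  private
    module A = AbelianGroup A
    module B = AbelianGroup B
  open GroupHomomorphism f

  hom-sum : ∀ {n} (t : Fin n → A.Carrier) →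
            ⟦ FiniteSum.sum A t ⟧ B.≈ FiniteSum.sum B (⟦_⟧ ∘ t)
  hom-sum {ℕ.zero}  t = ε-homo
  hom-sum {ℕ.suc n} t = B.trans (homo _ _) (B.∙-congˡ (hom-sum (t ∘ suc)))

idHom : ∀ {a b} {A : AbelianGroup a b} → AbHom A A
idHom {A = A} = mkHom {A = A} {B = A} id id (λ _ _ → AbelianGroup.refl A)

infixr 9 _∘ₕ_
_∘ₕ_ : ∀ {a b c d e f} {A : AbelianGroup a b} {B : AbelianGroup c d} {C : AbelianGroup e f} →
       AbHom B C → AbHom A B → AbHom A C
_∘ₕ_ {A = A} {C = C} g f = mkHom {A = A} {B = C} (g.⟦_⟧ ∘ f.⟦_⟧) (g.⟦⟧-cong ∘ f.⟦⟧-cong)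
  (λ x y → AbelianGroup.trans C (g.⟦⟧-cong (f.homo x y)) (g.homo _ _))
  where
  module g = GroupHomomorphism g
  module f = GroupHomomorphism f

subAbelianGroup : ∀ {a b p} (A : AbelianGroup a b) (let open AbelianGroup A) (P : Pred Carrier p) →
                  P ε → (∀ {x y} → P x → P y → P (x ∙ y)) → (∀ {x} → P x → P (x ⁻¹)) → AbelianGroup (a ⊔ p) b
subAbelianGroup A P _ _ _ .AbelianGroup.Carrier = Σ (AbelianGroup.Carrier A) P
subAbelianGroup A P _ _ _ .AbelianGroup._≈_ x y = AbelianGroup._≈_ A (proj₁ x) (proj₁ y)
subAbelianGroup A P _ P-∙ _ .AbelianGroup._∙_ x y = AbelianGroup._∙_ A (proj₁ x) (proj₁ y) , P-∙ (proj₂ x) (proj₂ y)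
subAbelianGroup A P P-ε _ _ .AbelianGroup.ε = AbelianGroup.ε A , P-ε
subAbelianGroup A P _ _ P-⁻¹ .AbelianGroup._⁻¹ x = AbelianGroup._⁻¹ A (proj₁ x) , P-⁻¹ (proj₂ x)
subAbelianGroup A P P-ε P-∙ P-⁻¹ .AbelianGroup.isAbelianGroup = record
  { isGroup = record
    { isMonoid = record
      { isSemigroup = record
        { isMagma = record
          { isEquivalence = record { refl = refl ; sym = sym ; trans = trans }
          ; ∙-cong        = ∙-cong
          }
        ; assoc = λ _ _ _ → assoc _ _ _
        }
      ; identity = (λ _ → identityˡ _) , (λ _ → identityʳ _)
      }
    ; inverse = (λ _ → inverseˡ _) , (λ _ → inverseʳ _)
    ; ⁻¹-cong = ⁻¹-cong
    }
  ; comm = λ _ _ → comm _ _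
  } where open AbelianGroup A

record TopologicalGroup (ℓ : Level) : Set (lsuc (lsuc ℓ)) where
  field
    group : Group ℓ ℓ
  open Group group public
  field
    IsOpen        : Pred Carrier ℓ → Set (lsuc ℓ)
    open-resp-≈   : ∀ {O x y} → IsOpen O → x ≈ y → x ∈ O → y ∈ O
    open-resp-≐   : ∀ {O O′} → O ≐ O′ → IsOpen O → IsOpen O′
    open-univ     : IsOpen (λ _ → ⊤)
    open-∩        : ∀ {O O′} → IsOpen O → IsOpen O′ → IsOpen (O ∩ O′)
    open-⋃        : (I : Set ℓ) (O : I → Pred Carrier ℓ) → (∀ i → IsOpen (O i)) → IsOpen (⋃ I O)
    -- preimages of open sets under multiplication are open in the product topology
    ∙-continuous  : ∀ {O} → IsOpen O → ∀ x y → (x ∙ y) ∈ O →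
                    ∃ λ V → ∃ λ W → IsOpen V × IsOpen W × x ∈ V × y ∈ W × (∀ {v w} → v ∈ V → w ∈ W → (v ∙ w) ∈ O)
    ⁻¹-continuous : ∀ {O} → IsOpen O → IsOpen (λ x → (x ⁻¹) ∈ O)

module Conjugation {ℓ} (G : Group ℓ ℓ) where
  open Group G
  open GroupProperties G
  open SetoidReasoning setoid

  κ : Carrier → Carrier → Carrier
  κ g x = g ⁻¹ ∙ x ∙ g

  κ-cong : ∀ {g g′ x x′} → g ≈ g′ → x ≈ x′ → κ g x ≈ κ g′ x′
  κ-cong p q = ∙-cong (∙-cong (⁻¹-cong p) q) p

  κ-ε : ∀ g → κ g ε ≈ ε
  κ-ε g = trans (∙-congʳ (identityʳ _)) (inverseˡ g)

  κ-∙ : ∀ g x y → κ g (x ∙ y) ≈ κ g x ∙ κ g y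
  κ-∙ g x y = sym (begin
    κ g x ∙ κ g y                      ≈⟨ assoc _ _ _ ⟩
    g ⁻¹ ∙ x ∙ (g ∙ (g ⁻¹ ∙ y ∙ g))    ≈⟨ ∙-congˡ (sym (assoc _ _ _)) ⟩
    g ⁻¹ ∙ x ∙ (g ∙ (g ⁻¹ ∙ y) ∙ g)    ≈⟨ ∙-congˡ (∙-congʳ (\\-leftDividesˡ g y)) ⟩
    g ⁻¹ ∙ x ∙ (y ∙ g)                 ≈⟨ sym (assoc _ _ _) ⟩
    g ⁻¹ ∙ x ∙ y ∙ g                   ≈⟨ ∙-congʳ (assoc _ _ _) ⟩
    κ g (x ∙ y)                        ∎)

  κ-⁻¹ : ∀ g x → κ g (x ⁻¹) ≈ κ g x ⁻¹
  κ-⁻¹ g x = inverseʳ-unique _ _ (begin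
    κ g x ∙ κ g (x ⁻¹)  ≈⟨ κ-∙ g x (x ⁻¹) ⟨
    κ g (x ∙ x ⁻¹)      ≈⟨ κ-cong refl (inverseʳ x) ⟩
    κ g ε               ≈⟨ κ-ε g ⟩
    ε                   ∎)

  κ-κ : ∀ g g′ x → κ g (κ g′ x) ≈ κ (g′ ∙ g) x
  κ-κ g g′ x = begin
    g ⁻¹ ∙ (g′ ⁻¹ ∙ x ∙ g′) ∙ g    ≈⟨ ∙-congʳ (sym (assoc _ _ _)) ⟩
    g ⁻¹ ∙ (g′ ⁻¹ ∙ x) ∙ g′ ∙ g    ≈⟨ assoc _ _ _ ⟩
    g ⁻¹ ∙ (g′ ⁻¹ ∙ x) ∙ (g′ ∙ g)  ≈⟨ ∙-congʳ (sym (assoc _ _ _)) ⟩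
    g ⁻¹ ∙ g′ ⁻¹ ∙ x ∙ (g′ ∙ g)    ≈⟨ ∙-congʳ (∙-congʳ (sym (⁻¹-anti-homo-∙ g′ g))) ⟩
    κ (g′ ∙ g) x                   ∎

  κ-id : ∀ x → κ ε x ≈ x
  κ-id x = trans (identityʳ _) (trans (∙-congʳ ε⁻¹≈ε) (identityˡ x))

  κ-invˡ : ∀ g x → κ (g ⁻¹) (κ g x) ≈ x
  κ-invˡ g x = trans (κ-κ _ _ x) (trans (κ-cong (inverseʳ g) refl) (κ-id x))

  κ-invʳ : ∀ g x → κ g (κ (g ⁻¹) x) ≈ x
  κ-invʳ g x = trans (κ-κ _ _ x) (trans (κ-cong (inverseˡ g) refl) (κ-id x))

  ∙-κ : ∀ g x → g ∙ κ g x ≈ x ∙ g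
  ∙-κ g x = trans (sym (assoc _ _ _)) (∙-congʳ (\\-leftDividesˡ g x))

record Subgroup {ℓ} (G : TopologicalGroup ℓ) : Set (lsuc ℓ) where
  open TopologicalGroup G
  field
    ∣_∣    : Pred Carrier ℓ
    resp   : ∀ {x y} → x ≈ y → x ∈ ∣_∣ → y ∈ ∣_∣
    ε∈     : ε ∈ ∣_∣
    ∙∈     : ∀ {x y} → x ∈ ∣_∣ → y ∈ ∣_∣ → (x ∙ y) ∈ ∣_∣
    ⁻¹∈    : ∀ {x} → x ∈ ∣_∣ → (x ⁻¹) ∈ ∣_∣

open Subgroup public using (∣_∣)

module _ {ℓ} {G : TopologicalGroup ℓ} where
  open TopologicalGroup G
  open GroupProperties group using (\\-leftDividesˡ; ⁻¹-anti-homo-\\)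
  open Conjugation group

  -- gHg⁻¹, using x ∈ gHg⁻¹ ⇔ g⁻¹xg ∈ H
  conj : Carrier → Subgroup G → Subgroup G
  conj g H = record
    { ∣_∣ = λ x → (g ⁻¹ ∙ x ∙ g) ∈ ∣ H ∣
    ; resp = λ eq → H.resp (κ-cong refl eq)
    ; ε∈   = H.resp (sym (κ-ε g)) H.ε∈
    ; ∙∈   = λ x∈ y∈ → H.resp (sym (κ-∙ g _ _)) (H.∙∈ x∈ y∈)
    ; ⁻¹∈  = λ x∈ → H.resp (sym (κ-⁻¹ g _)) (H.⁻¹∈ x∈)
    } where module H = Subgroup H

  infixr 7 _∩ₛ_
  _∩ₛ_ : Subgroup G → Subgroup G → Subgroup G
  H ∩ₛ K = record
    { ∣_∣  = ∣ H ∣ ∩ ∣ K ∣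
    ; resp = λ eq (x∈H , x∈K) → H.resp eq x∈H , K.resp eq x∈K
    ; ε∈   = H.ε∈ , K.ε∈
    ; ∙∈   = λ (x∈H , x∈K) (y∈H , y∈K) → H.∙∈ x∈H y∈H , K.∙∈ x∈K y∈K
    ; ⁻¹∈  = λ (x∈H , x∈K) → H.⁻¹∈ x∈H , K.⁻¹∈ x∈K
    }
    where
    module H = Subgroup H
    module K = Subgroup K

  IsNormal : Subgroup G → Set ℓ
  IsNormal N = ∀ g → ∣ conj g N ∣ ≐ ∣ N ∣

  -- H/I (for I ≤ H): elements of H, with x ~ y iff xI = yI
  Cosets : Subgroup G → Subgroup G → Setoid ℓ ℓ
  Cosets H I = record
    { Carrier = Σ Carrier ∣ H ∣
    ; _≈_ = λ x y → (proj₁ x ⁻¹ ∙ proj₁ y) ∈ ∣ I ∣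
    ; isEquivalence = record
      { refl  = I.resp (sym (inverseˡ _)) I.ε∈
      ; sym   = λ p → I.resp (⁻¹-anti-homo-\\ _ _) (I.⁻¹∈ p)
      ; trans = λ p q → I.resp (trans (assoc _ _ _) (∙-congˡ (\\-leftDividesˡ _ _))) (I.∙∈ p q)
      }
    } where module I = Subgroup I

  -- I\H/J (for I, J ≤ H): elements of H, with x ~ y iff y ∈ IxJ
  DoubleCosets : Subgroup G → Subgroup G → Subgroup G → Setoid ℓ ℓ
  DoubleCosets I H J = record
    { Carrier = Σ Carrier ∣ H ∣
    ; _≈_ = λ x y → ∃ λ i → ∃ λ j → i ∈ ∣ I ∣ × j ∈ ∣ J ∣ × proj₁ y ≈ i ∙ proj₁ x ∙ j
    ; isEquivalence = record
      { refl  = ε , ε , I.ε∈ , J.ε∈ , sym (trans (identityʳ _) (identityˡ _))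
      ; sym   = λ {x} {y} (i , j , i∈ , j∈ , eq) → i ⁻¹ , j ⁻¹ , I.⁻¹∈ i∈ , J.⁻¹∈ j∈ ,
                  (let x = proj₁ x in let y = proj₁ y in begin
                    x                          ≈⟨ identityʳ x ⟨
                    x ∙ ε                      ≈⟨ ∙-congˡ (inverseʳ j) ⟨
                    x ∙ (j ∙ j ⁻¹)             ≈⟨ assoc _ _ _ ⟨
                    x ∙ j ∙ j ⁻¹               ≈⟨ ∙-congʳ (\\-leftDividesʳ i (x ∙ j)) ⟨
                    i ⁻¹ ∙ (i ∙ (x ∙ j)) ∙ j ⁻¹ ≈⟨ ∙-congʳ (∙-congˡ (assoc _ _ _)) ⟨
                    i ⁻¹ ∙ (i ∙ x ∙ j) ∙ j ⁻¹  ≈⟨ ∙-congʳ (∙-congˡ eq) ⟨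
                    i ⁻¹ ∙ y ∙ j ⁻¹            ∎)
      ; trans = λ {x} {y} {z} (i , j , i∈ , j∈ , eq) (i′ , j′ , i′∈ , j′∈ , eq′) →
                  i′ ∙ i , j ∙ j′ , I.∙∈ i′∈ i∈ , J.∙∈ j∈ j′∈ ,
                  (let x = proj₁ x in let y = proj₁ y in let z = proj₁ z in begin
                    z                            ≈⟨ eq′ ⟩
                    i′ ∙ y ∙ j′                  ≈⟨ ∙-congʳ (∙-congˡ eq) ⟩
                    i′ ∙ (i ∙ x ∙ j) ∙ j′        ≈⟨ ∙-congʳ (assoc _ _ _) ⟨
                    i′ ∙ (i ∙ x) ∙ j ∙ j′        ≈⟨ ∙-congʳ (∙-congʳ (assoc _ _ _)) ⟨
                    i′ ∙ i ∙ x ∙ j ∙ j′          ≈⟨ assoc _ _ _ ⟩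
                    i′ ∙ i ∙ x ∙ (j ∙ j′)        ∎)
      }
    }
    where
    module I = Subgroup I
    module J = Subgroup J
    open SetoidReasoning setoid
    open GroupProperties group using (\\-leftDividesʳ)

  κ-closed : (H : Subgroup G) → ∀ {g x} → g ∈ ∣ H ∣ → x ∈ ∣ H ∣ → κ g x ∈ ∣ H ∣
  κ-closed H g∈ x∈ = H.∙∈ (H.∙∈ (H.⁻¹∈ g∈) x∈) g∈
    where module H = Subgroup H

  conj-self : (H : Subgroup G) → ∀ {h} → h ∈ ∣ H ∣ → ∣ conj h H ∣ ≐ ∣ H ∣
  conj-self H h∈ = (λ x∈ → H.resp (κ-invˡ _ _) (κ-closed H (H.⁻¹∈ h∈) x∈)) , κ-closed H h∈
    where module H = Subgroup H

  conj-cong : (H K : Subgroup G) → ∀ {g g′} → g ≈ g′ → ∣ H ∣ ≐ ∣ K ∣ → ∣ conj g H ∣ ≐ ∣ conj g′ K ∣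
  conj-cong H K eq (H⊆K , K⊆H) = (λ x∈ → K.resp (κ-cong eq refl) (H⊆K x∈)) , (λ x∈ → H.resp (κ-cong (sym eq) refl) (K⊆H x∈))
    where
    module H = Subgroup H
    module K = Subgroup K

  conj-conj : (H : Subgroup G) → ∀ g g′ → ∣ conj g′ (conj g H) ∣ ≐ ∣ conj (g′ ∙ g) H ∣
  conj-conj H g g′ = (λ x∈ → H.resp (κ-κ g g′ _) x∈) , (λ x∈ → H.resp (sym (κ-κ g g′ _)) x∈)
    where module H = Subgroup H

  conj-∩ : (I J : Subgroup G) → ∀ h → ∣ conj h (conj (h ⁻¹) I ∩ₛ J) ∣ ≐ ∣ I ∩ₛ conj h J ∣
  conj-∩ I J h = (λ (x∈I , x∈J) → I.resp (κ-invˡ h _) x∈I , x∈J) , (λ (x∈I , x∈J) → I.resp (sym (κ-invˡ h _)) x∈I , x∈J)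
    where module I = Subgroup I

≐-refl : ∀ {a p} {A : Set a} {P : Pred A p} → P ≐ P
≐-refl = (λ x → x) , (λ x → x)

≐-sym : ∀ {a p q} {A : Set a} {P : Pred A p} {Q : Pred A q} → P ≐ Q → Q ≐ P
≐-sym (f , g) = g , f

≐-trans : ∀ {a p q r} {A : Set a} {P : Pred A p} {Q : Pred A q} {R : Pred A r} → P ≐ Q → Q ≐ R → P ≐ R
≐-trans (f , g) (f′ , g′) = (λ x → f′ (f x)) , (λ x → g (g′ x))

-- A set of subgroups is a predicate invariant under equality of subgroups.
record BaseSet {ℓ} (G : TopologicalGroup ℓ) : Set (lsuc (lsuc ℓ)) where
  open TopologicalGroup G using (Carrier)
  field
    b        : Pred (Subgroup G) (lsuc ℓ)
    b-resp   : ∀ {H K} → ∣ H ∣ ≐ ∣ K ∣ → H ∈ b → K ∈ b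
    nonempty : ∃ b
    b-conj   : ∀ g {H} → H ∈ b → conj g H ∈ b

  𝔖ᵇ : Set (lsuc ℓ)
  𝔖ᵇ = Σ (Subgroup G) b

  ⟪_⟫ : 𝔖ᵇ → Pred Carrier ℓ
  ⟪ H ⟫ = ∣ proj₁ H ∣

  conjᵇ : Carrier → 𝔖ᵇ → 𝔖ᵇ
  conjᵇ g (H , H∈b) = conj g H , b-conj g H∈b

record IsFamily {ℓ} {G : TopologicalGroup ℓ} (base : BaseSet G)
                (S : BaseSet.𝔖ᵇ base → Pred (BaseSet.𝔖ᵇ base) (lsuc ℓ)) : Set (lsuc ℓ) where
  open BaseSet base
  field
    resp    : ∀ {H H′ I I′} → ⟪ H ⟫ ≐ ⟪ H′ ⟫ → ⟪ I ⟫ ≐ ⟪ I′ ⟫ → I ∈ S H → I′ ∈ S H′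
    below   : ∀ {H I} → I ∈ S H → ⟪ I ⟫ ⊆ ⟪ H ⟫
    self    : ∀ {H} → H ∈ S H
    trans   : ∀ {H I} → I ∈ S H → S I ⊆ S H
    -- the inclusions ᵍS(H) ⊆ S(ᵍH) and S(ᵍH) ⊆ ᵍS(H)
    conj-⊆  : ∀ g {H I} → I ∈ S H → conjᵇ g I ∈ S (conjᵇ g H)
    conj-⊇  : ∀ g {H K} → K ∈ S (conjᵇ g H) → ∃ λ I → I ∈ S H × ⟪ K ⟫ ≐ ⟪ conjᵇ g I ⟫

record SubgroupSystem {ℓ} (G : TopologicalGroup ℓ) : Set (lsuc (lsuc ℓ)) where
  field
    base : BaseSet G
  open BaseSet base public
  field
    r         : 𝔖ᵇ → Pred 𝔖ᵇ (lsuc ℓ)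
    i         : 𝔖ᵇ → Pred 𝔖ᵇ (lsuc ℓ)
    r-family  : IsFamily base r
    i-family  : IsFamily base i

  module R = IsFamily r-family
  module I = IsFamily i-family

record MackeySystem {ℓ} (G : TopologicalGroup ℓ) : Set (lsuc (lsuc ℓ)) where
  open TopologicalGroup G using (Carrier; _⁻¹)
  field
    subgroupSystem : SubgroupSystem G
  open SubgroupSystem subgroupSystem public
  field
    double-finite : ∀ {H I J} → I ∈ r H → J ∈ i H → Finite (DoubleCosets (proj₁ I) (proj₁ H) (proj₁ J))
    ∩∈b           : ∀ {H I J} → I ∈ r H → J ∈ i H → (proj₁ I ∩ₛ proj₁ J) ∈ b
    ∩∈r           : ∀ {H I J} (p : I ∈ r H) (q : J ∈ i H) → (proj₁ I ∩ₛ proj₁ J , ∩∈b p q) ∈ r J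
    ∩∈i           : ∀ {H I J} (p : I ∈ r H) (q : J ∈ i H) → (proj₁ I ∩ₛ proj₁ J , ∩∈b p q) ∈ i I

  module _ {H I J} (p : I ∈ r H) (q : J ∈ i H) {h : Carrier} (h∈H : h ∈ ⟪ H ⟫) where
    private
      Iʰ∈r : conjᵇ (h ⁻¹) I ∈ r H
      Iʰ∈r = R.resp (conj-self (proj₁ H) (Subgroup.⁻¹∈ (proj₁ H) h∈H)) ≐-refl (R.conj-⊆ (h ⁻¹) p)
      ʰJ∈i : conjᵇ h J ∈ i H
      ʰJ∈i = I.resp (conj-self (proj₁ H) h∈H) ≐-refl (I.conj-⊆ h q)

    Iʰ∩J : 𝔖ᵇ
    Iʰ∩J = conj (h ⁻¹) (proj₁ I) ∩ₛ proj₁ J , ∩∈b Iʰ∈r q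

    Iʰ∩J∈r : Iʰ∩J ∈ r J
    Iʰ∩J∈r = ∩∈r Iʰ∈r q

    I∩ʰJ : 𝔖ᵇ
    I∩ʰJ = proj₁ I ∩ₛ conj h (proj₁ J) , ∩∈b p ʰJ∈i

    I∩ʰJ∈i : I∩ʰJ ∈ i I
    I∩ʰJ∈i = ∩∈i p ʰJ∈i

    conj-Iʰ∩J : ⟪ conjᵇ h Iʰ∩J ⟫ ≐ ⟪ I∩ʰJ ⟫
    conj-Iʰ∩J = conj-∩ (proj₁ I) (proj₁ J) h

IFinite : ∀ {ℓ} {G : TopologicalGroup ℓ} → SubgroupSystem G → Set (lsuc ℓ)
IFinite 𝔖 = ∀ {H I} → I ∈ i H → Finite (Cosets (proj₁ H) (proj₁ I))
  where open SubgroupSystem 𝔖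

module _ {ℓ} {G : TopologicalGroup ℓ} (m : Level) (𝔐 : MackeySystem G) where
  open TopologicalGroup G using (Carrier; _⁻¹) renaming (_≈_ to _≈ᴳ_; _∙_ to _∙ᴳ_)
  open MackeySystem 𝔐

  -- Equality of subgroups is mutual inclusion, so Φ comes with the identifications
  -- cast : Φ(H) → Φ(H′) for H = H′, along which the equations are stated.
  -- (The INLINE constructors and the absence of η only keep conversion checking fast.)
  record MackeyFunctor : Set (lsuc (lsuc ℓ ⊔ m)) where
    no-eta-equality
    constructor mkMackeyFunctor
    field
      val : 𝔖ᵇ → AbelianGroup (lsuc ℓ ⊔ m) (lsuc ℓ ⊔ m)

    Elt : 𝔖ᵇ → Set (lsuc ℓ ⊔ m)
    Elt H = AbelianGroup.Carrier (val H)

    infix 4 _≈_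
    _≈_ : ∀ {H} → Elt H → Elt H → Set (lsuc ℓ ⊔ m)
    _≈_ {H} = AbelianGroup._≈_ (val H)

    field
      castHom : ∀ {H H′} → ⟪ H ⟫ ≐ ⟪ H′ ⟫ → AbHom (val H) (val H′)
      resHom  : ∀ {H I} → I ∈ r H → AbHom (val H) (val I)
      indHom  : ∀ {H I} → I ∈ i H → AbHom (val I) (val H)
      conHom  : ∀ g H → AbHom (val H) (val (conjᵇ g H))

    cast : ∀ {H H′} → ⟪ H ⟫ ≐ ⟪ H′ ⟫ → Elt H → Elt H′
    cast {H} {H′} e = GroupHomomorphism.⟦_⟧ (castHom {H} {H′} e)

    res : ∀ {H I} → I ∈ r H → Elt H → Elt I
    res p = GroupHomomorphism.⟦_⟧ (resHom p)

    ind : ∀ {H I} → I ∈ i H → Elt I → Elt H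
    ind q = GroupHomomorphism.⟦_⟧ (indHom q)

    con : ∀ g {H} → Elt H → Elt (conjᵇ g H)
    con g {H} = GroupHomomorphism.⟦_⟧ (conHom g H)

    field
      cast-id    : ∀ {H} (e : ⟪ H ⟫ ≐ ⟪ H ⟫) (a : Elt H) → cast {H} {H} e a ≈ a
      cast-trans : ∀ {H H′ H″} (e : ⟪ H ⟫ ≐ ⟪ H′ ⟫) (e′ : ⟪ H′ ⟫ ≐ ⟪ H″ ⟫) (e″ : ⟪ H ⟫ ≐ ⟪ H″ ⟫) (a : Elt H) →
                   cast {H′} {H″} e′ (cast {H} {H′} e a) ≈ cast {H} {H″} e″ a
      res-cast   : ∀ {H H′ I I′} (e : ⟪ H ⟫ ≐ ⟪ H′ ⟫) (e′ : ⟪ I ⟫ ≐ ⟪ I′ ⟫) (p : I ∈ r H) (p′ : I′ ∈ r H′) (a : Elt H) →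
                   cast {I} {I′} e′ (res p a) ≈ res p′ (cast {H} {H′} e a)
      ind-cast   : ∀ {H H′ I I′} (e : ⟪ H ⟫ ≐ ⟪ H′ ⟫) (e′ : ⟪ I ⟫ ≐ ⟪ I′ ⟫) (q : I ∈ i H) (q′ : I′ ∈ i H′) (a : Elt I) →
                   cast {H} {H′} e (ind q a) ≈ ind q′ (cast {I} {I′} e′ a)
      con-cast   : ∀ {g g′ H H′} → g ≈ᴳ g′ → (e : ⟪ H ⟫ ≐ ⟪ H′ ⟫) (e′ : ⟪ conjᵇ g H ⟫ ≐ ⟪ conjᵇ g′ H′ ⟫) (a : Elt H) →
                   cast {conjᵇ g H} {conjᵇ g′ H′} e′ (con g a) ≈ con g′ (cast {H} {H′} e a)

      res-id     : ∀ {H} (p : H ∈ r H) (a : Elt H) → res p a ≈ a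
      ind-id     : ∀ {H} (q : H ∈ i H) (a : Elt H) → ind q a ≈ a
      con-id     : ∀ {h H} → h ∈ ⟪ H ⟫ → (e : ⟪ conjᵇ h H ⟫ ≐ ⟪ H ⟫) (a : Elt H) →
                   cast {conjᵇ h H} {H} e (con h a) ≈ a

      res-res    : ∀ {H I J} (p : I ∈ r H) (p′ : J ∈ r I) (a : Elt H) → res p′ (res p a) ≈ res (R.trans p p′) a
      ind-ind    : ∀ {H I J} (q : I ∈ i H) (q′ : J ∈ i I) (a : Elt J) → ind q (ind q′ a) ≈ ind (I.trans q q′) a
      con-con    : ∀ g g′ {H} (e : ⟪ conjᵇ g′ (conjᵇ g H) ⟫ ≐ ⟪ conjᵇ (g′ ∙ᴳ g) H ⟫) (a : Elt H) →
                   cast {conjᵇ g′ (conjᵇ g H)} {conjᵇ (g′ ∙ᴳ g) H} e (con g′ (con g a)) ≈ con (g′ ∙ᴳ g) a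

      con-res    : ∀ g {H I} (p : I ∈ r H) (a : Elt H) → con g (res p a) ≈ res (R.conj-⊆ g p) (con g a)
      con-ind    : ∀ g {H I} (q : I ∈ i H) (a : Elt I) → con g (ind q a) ≈ ind (I.conj-⊆ g q) (con g a)

      -- for every system of representatives of I\H/J
      mackey     : ∀ {H I J} (p : I ∈ r H) (q : J ∈ i H)
                   (reps : Finite (DoubleCosets (proj₁ I) (proj₁ H) (proj₁ J))) (a : Elt J) →
                   res p (ind q a) ≈ FiniteSum.sumOver (val I) reps λ (h , h∈H) →
                     ind (I∩ʰJ∈i p q h∈H)
                       (cast {conjᵇ h (Iʰ∩J p q h∈H)} {I∩ʰJ p q h∈H} (conj-Iʰ∩J p q h∈H)
                         (con h (res (Iʰ∩J∈r p q h∈H) a)))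

  {-# INLINE mkMackeyFunctor #-}

  record MackeyMorphism (Φ Ψ : MackeyFunctor) : Set (lsuc ℓ ⊔ m) where
    no-eta-equality
    constructor mkMackeyMorphism
    private
      module Φ = MackeyFunctor Φ
      module Ψ = MackeyFunctor Ψ
    field
      hom : ∀ H → AbHom (Φ.val H) (Ψ.val H)

    ⟦_⟧ : ∀ {H} → Φ.Elt H → Ψ.Elt H
    ⟦_⟧ {H} = GroupHomomorphism.⟦_⟧ (hom H)

    field
      hom-res : ∀ {H I} (p : I ∈ r H) (a : Φ.Elt H) → ⟦ Φ.res p a ⟧ Ψ.≈ Ψ.res p ⟦ a ⟧
      hom-ind : ∀ {H I} (q : I ∈ i H) (a : Φ.Elt I) → ⟦ Φ.ind q a ⟧ Ψ.≈ Ψ.ind q ⟦ a ⟧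
      hom-con : ∀ g {H} (a : Φ.Elt H) → ⟦ Φ.con g a ⟧ Ψ.≈ Ψ.con g ⟦ a ⟧

  {-# INLINE mkMackeyMorphism #-}

module _ {ℓ} {G : TopologicalGroup ℓ} {m : Level} {𝔐 : MackeySystem G} where
  open MackeySystem 𝔐

  idMackey : {Φ : MackeyFunctor m 𝔐} → MackeyMorphism m 𝔐 Φ Φ
  idMackey {Φ} = record
    { hom     = λ H → idHom {A = Φ.val H}
    ; hom-res = λ {_} {I} _ _ → AbelianGroup.refl (Φ.val I)
    ; hom-ind = λ {H} _ _ → AbelianGroup.refl (Φ.val H)
    ; hom-con = λ g {H} _ → AbelianGroup.refl (Φ.val (conjᵇ g H))
    } where module Φ = MackeyFunctor Φ

  composeMackey : {Φ Ψ Ω : MackeyFunctor m 𝔐} → MackeyMorphism m 𝔐 Ψ Ω → MackeyMorphism m 𝔐 Φ Ψ → MackeyMorphism m 𝔐 Φ Ω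
  composeMackey {Φ} {Ψ} {Ω} β α = record
    { hom     = λ H → _∘ₕ_ {A = Φ.val H} {B = Ψ.val H} {C = Ω.val H} (β.hom H) (α.hom H)
    ; hom-res = λ {_} {I} p a → AbelianGroup.trans (Ω.val I) (⟦⟧-cong (β.hom I) (α.hom-res p a)) (β.hom-res p _)
    ; hom-ind = λ {H} q a → AbelianGroup.trans (Ω.val H) (⟦⟧-cong (β.hom H) (α.hom-ind q a)) (β.hom-ind q _)
    ; hom-con = λ g {H} a → AbelianGroup.trans (Ω.val (conjᵇ g H)) (⟦⟧-cong (β.hom (conjᵇ g H)) (α.hom-con g a)) (β.hom-con g _)
    }
    where
    module Φ = MackeyFunctor Φ
    module Ψ = MackeyFunctor Ψ
    module Ω = MackeyFunctor Ω
    module α = MackeyMorphism α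
    module β = MackeyMorphism β
    open GroupHomomorphism using (⟦⟧-cong)

  hom-cast : {Φ Ψ : MackeyFunctor m 𝔐} (let module Φ = MackeyFunctor Φ) (let module Ψ = MackeyFunctor Ψ)
             (α : MackeyMorphism m 𝔐 Φ Ψ) (let open MackeyMorphism α) →
             ∀ {H H′} (e : ⟪ H ⟫ ≐ ⟪ H′ ⟫) (a : Φ.Elt H) → ⟦ Φ.cast {H} {H′} e a ⟧ Ψ.≈ Ψ.cast {H} {H′} e ⟦ a ⟧
  hom-cast {Φ} {Ψ} α {H} {H′} e a = begin
    ⟦ Φ.cast {H} {H′} e a ⟧  ≈⟨ GroupHomomorphism.⟦⟧-cong (hom H′) (cast≈res Φ a) ⟩
    ⟦ Φ.res p a ⟧            ≈⟨ hom-res p a ⟩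
    Ψ.res p ⟦ a ⟧            ≈⟨ cast≈res Ψ ⟦ a ⟧ ⟨
    Ψ.cast {H} {H′} e ⟦ a ⟧  ∎
    where
    module Φ = MackeyFunctor Φ
    module Ψ = MackeyFunctor Ψ
    open MackeyMorphism α
    open SetoidReasoning (AbelianGroup.setoid (Ψ.val H′))
    p : H′ ∈ r H
    p = R.resp {H} {H} {H} {H′} ≐-refl e R.self
    cast≈res : (Ω : MackeyFunctor m 𝔐) (let open MackeyFunctor Ω) (x : Elt H) → cast {H} {H′} e x ≈ res p x
    cast≈res Ω x = trans (sym (res-id R.self _)) (trans (sym (res-cast {H} {H′} {H′} {H′} e ≐-refl p R.self x)) (cast-id {H′} ≐-refl _))
      where
      open MackeyFunctor Ω
      open AbelianGroup (val H′) using (trans; sym)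

module _ {ℓ} {G : TopologicalGroup ℓ} (m : Level) (𝔐 : MackeySystem G) where
  Mack : Category (lsuc (lsuc ℓ ⊔ m)) (lsuc ℓ ⊔ m) (lsuc ℓ ⊔ m)
  Mack = record
    { Obj       = MackeyFunctor m 𝔐
    ; Hom       = MackeyMorphism m 𝔐
    ; _≈_       = λ {Φ} {Ψ} α β → ∀ {H} (a : MackeyFunctor.Elt Φ H) →
                    MackeyFunctor._≈_ Ψ (MackeyMorphism.⟦_⟧ α a) (MackeyMorphism.⟦_⟧ β a)
    ; idₘ       = idMackey
    ; _∙_       = composeMackey
    ; isEquiv   = λ {Φ} {Ψ} → let open MackeyFunctor Ψ in record
      { refl  = λ {_} {H} _ → AbelianGroup.refl (val H)
      ; sym   = λ p {H} a → AbelianGroup.sym (val H) (p a)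
      ; trans = λ p q {H} a → AbelianGroup.trans (val H) (p a) (q a)
      }
    ; ∙-cong    = λ {_} {_} {Ω} {β} p q {H} a →
                    AbelianGroup.trans (MackeyFunctor.val Ω H)
                      (GroupHomomorphism.⟦⟧-cong (MackeyMorphism.hom β H) (q a)) (p _)
    ; identityˡ = λ {_} {Ψ} {_} {H} _ → AbelianGroup.refl (MackeyFunctor.val Ψ H)
    ; identityʳ = λ {_} {Ψ} {_} {H} _ → AbelianGroup.refl (MackeyFunctor.val Ψ H)
    ; assoc     = λ {_} {_} {_} {Ω} {_} {_} {_} {H} _ → AbelianGroup.refl (MackeyFunctor.val Ω H)
    }

record DiscreteModule {ℓ} (m : Level) (G : TopologicalGroup ℓ) : Set (lsuc (lsuc ℓ ⊔ m)) where
  no-eta-equality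
  constructor mkDiscreteModule
  private module G = TopologicalGroup G
  field
    abelianGroup : AbelianGroup (lsuc ℓ ⊔ m) (lsuc ℓ ⊔ m)
  open AbelianGroup abelianGroup public renaming (_∙_ to _+_; ε to 0#; _⁻¹ to -_; ∙-cong to +-cong)
  infixr 8 _·_
  field
    _·_       : G.Carrier → Carrier → Carrier
    ·-cong    : ∀ {g h a b} → g G.≈ h → a ≈ b → g · a ≈ h · b
    ·-distrib : ∀ g a b → g · (a + b) ≈ g · a + g · b
    ·-id      : ∀ a → G.ε · a ≈ a
    ·-assoc   : ∀ g h a → (g G.∙ h) · a ≈ g · h · a
    -- continuity of the action G × A → A for the discrete topology on A
    discrete  : ∀ g a → ∃ λ V → G.IsOpen V × g ∈ V × (∀ {v} → v ∈ V → v · a ≈ g · a)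

  act : G.Carrier → AbHom abelianGroup abelianGroup
  act g = mkHom {A = abelianGroup} {B = abelianGroup} (g ·_) (·-cong G.refl) (·-distrib g)

{-# INLINE mkDiscreteModule #-}

record ModuleMorphism {ℓ} {m : Level} {G : TopologicalGroup ℓ} (A B : DiscreteModule m G) : Set (lsuc ℓ ⊔ m) where
  no-eta-equality
  constructor mkModuleMorphism
  private
    module A = DiscreteModule A
    module B = DiscreteModule B
  field
    hom : AbHom A.abelianGroup B.abelianGroup
  open GroupHomomorphism hom public
  field
    equivariant : ∀ g a → ⟦ g A.· a ⟧ B.≈ g B.· ⟦ a ⟧

{-# INLINE mkModuleMorphism #-}

module _ {ℓ} {m : Level} {G : TopologicalGroup ℓ} where
  open ModuleMorphism
  open DiscreteModule using (abelianGroup)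

  idModule : {A : DiscreteModule m G} → ModuleMorphism A A
  idModule {A} = record
    { hom         = idHom {A = abelianGroup A}
    ; equivariant = λ _ _ → DiscreteModule.refl A
    }

  composeModule : {A B C : DiscreteModule m G} → ModuleMorphism B C → ModuleMorphism A B → ModuleMorphism A C
  composeModule {A} {B} {C} g f = record
    { hom         = _∘ₕ_ {A = abelianGroup A} {B = abelianGroup B} {C = abelianGroup C} (hom g) (hom f)
    ; equivariant = λ x a → DiscreteModule.trans C (⟦⟧-cong g (equivariant f x a)) (equivariant g x _)
    }

Mod : ∀ {ℓ} (m : Level) (G : TopologicalGroup ℓ) → Category (lsuc (lsuc ℓ ⊔ m)) (lsuc ℓ ⊔ m) (lsuc ℓ ⊔ m)
Mod m G = record
  { Obj       = DiscreteModule m G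
  ; Hom       = ModuleMorphism
  ; _≈_       = λ {_} {B} f g → ∀ a → DiscreteModule._≈_ B (⟦_⟧ f a) (⟦_⟧ g a)
  ; idₘ       = idModule
  ; _∙_       = composeModule
  ; isEquiv   = λ {_} {B} → let module B = DiscreteModule B in record
    { refl  = λ _ → B.refl
    ; sym   = λ p a → B.sym (p a)
    ; trans = λ p q a → B.trans (p a) (q a)
    }
  ; ∙-cong    = λ {_} {_} {C} {f} p q a → DiscreteModule.trans C (⟦⟧-cong f (q a)) (p _)
  ; identityˡ = λ {_} {B} _ → DiscreteModule.refl B
  ; identityʳ = λ {_} {B} _ → DiscreteModule.refl B
  ; assoc     = λ {_} {_} {_} {D} _ → DiscreteModule.refl D
  }
  where open ModuleMorphism using (⟦_⟧; ⟦⟧-cong)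

module _ {ℓ} {m : Level} {G : TopologicalGroup ℓ} (A : DiscreteModule m G) where
  open TopologicalGroup G renaming (_≈_ to _≈ᴳ_; refl to reflᴳ; sym to symᴳ; trans to transᴳ) hiding (setoid)
  open DiscreteModule A using (_·_; ·-cong; ·-distrib; ·-id; ·-assoc; act; abelianGroup; _≈_; refl; sym; trans; setoid; 0#)
  private module A = DiscreteModule A
  open FiniteSum abelianGroup
  open GroupProperties group using (\\-leftDividesˡ; \\-leftDividesʳ; //-rightDividesˡ; ⁻¹-anti-homo-∙; ⁻¹-involutive)
  open Conjugation group

  FixedBy : Subgroup G → Pred A.Carrier (lsuc ℓ ⊔ m)
  FixedBy H a = ∀ h → h ∈ ∣ H ∣ → h · a ≈ a

  abstract
    0-fixed : ∀ H → FixedBy H 0#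
    0-fixed H h _ = GroupHomomorphism.ε-homo (act h)

    +-fixed : ∀ H {a b} → FixedBy H a → FixedBy H b → FixedBy H (a A.+ b)
    +-fixed H p q h h∈ = trans (·-distrib h _ _) (A.+-cong (p h h∈) (q h h∈))

    neg-fixed : ∀ H {a} → FixedBy H a → FixedBy H (A.- a)
    neg-fixed H p h h∈ = trans (GroupHomomorphism.⁻¹-homo (act h) _) (A.⁻¹-cong (p h h∈))

  fixedPoints : Subgroup G → AbelianGroup (lsuc ℓ ⊔ m) (lsuc ℓ ⊔ m)
  fixedPoints H = subAbelianGroup abelianGroup (FixedBy H) (0-fixed H) (+-fixed H) (neg-fixed H)

  fixed-coset : (I : Subgroup G) → ∀ {a x y} → FixedBy I a → (x ⁻¹ ∙ y) ∈ ∣ I ∣ → x · a ≈ y · a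
  fixed-coset I {a} {x} {y} a-fixed p = begin
    x · a                  ≈⟨ ·-cong reflᴳ (a-fixed _ p) ⟨
    x · (x ⁻¹ ∙ y) · a     ≈⟨ ·-assoc _ _ _ ⟨
    (x ∙ (x ⁻¹ ∙ y)) · a   ≈⟨ ·-cong (\\-leftDividesˡ x y) refl ⟩
    y · a                  ∎
    where open SetoidReasoning setoid

  translate-quotient : ∀ k x y → (k ∙ x) ⁻¹ ∙ (k ∙ y) ≈ᴳ x ⁻¹ ∙ y
  translate-quotient k x y = transᴳ (∙-congʳ (⁻¹-anti-homo-∙ k x)) (transᴳ (assoc _ _ _) (∙-congˡ (\\-leftDividesʳ k y)))

  module _ (H I : Subgroup G) (fin : Finite (Cosets H I)) where
    private module I = Subgroup I

    transfer : A.Carrier → A.Carrier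
    transfer a = sumOver fin λ (h , _) → h · a

    transfer-fixed : ∀ {a} → FixedBy I a → FixedBy H (transfer a)
    transfer-fixed {a} a-fixed k k∈ = trans (hom-sum {A = abelianGroup} {B = abelianGroup} (act k) {proj₁ fin} _)
      (sum-bijection fin fin (λ (h , h∈) → k ∙ h , H.∙∈ k∈ h∈)
        (λ p → I.resp (symᴳ (translate-quotient k _ _)) p)
        (λ p → I.resp (translate-quotient k _ _) p)
        (λ (z , z∈) → (k ⁻¹ ∙ z , H.∙∈ (H.⁻¹∈ k∈) z∈) ,
          I.resp (symᴳ (transᴳ (∙-congʳ (⁻¹-cong (\\-leftDividesˡ k z))) (inverseˡ z))) I.ε∈)
        _ _ (fixed-coset I a-fixed) (λ (h , _) → sym (·-assoc k h a)))
      where module H = Subgroup H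

    transferHom : AbHom (fixedPoints I) (fixedPoints H)
    transferHom = mkHom {A = fixedPoints I} {B = fixedPoints H}
      (λ (a , a-fixed) → transfer a , transfer-fixed a-fixed)
      (λ p → sum-cong {proj₁ fin} (λ _ → ·-cong reflᴳ p))
      (λ _ _ → trans (sum-cong {proj₁ fin} (λ _ → ·-distrib _ _ _)) (∑-distrib-+ {proj₁ fin} _ _))

  transfer-cast : (H H′ I I′ : Subgroup G) (fin : Finite (Cosets H I)) (fin′ : Finite (Cosets H′ I′)) →
                  ∣ H ∣ ≐ ∣ H′ ∣ → ∣ I ∣ ≐ ∣ I′ ∣ → ∀ {a} → FixedBy I a → transfer H I fin a ≈ transfer H′ I′ fin′ a
  transfer-cast H H′ I I′ fin fin′ e e′ a-fixed = sum-bijection fin fin′ (λ (h , h∈) → h , proj₁ e h∈)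
    (proj₁ e′) (proj₂ e′)
    (λ (z , z∈) → (z , proj₂ e z∈) , Setoid.refl (Cosets H′ I′) {z , z∈})
    _ _ (λ p → fixed-coset I a-fixed (proj₂ e′ p)) (λ _ → refl)

  transfer-self : (H : Subgroup G) (fin : Finite (Cosets H H)) → ∀ {a} → FixedBy H a → transfer H H fin a ≈ a
  transfer-self H fin {a} a-fixed = trans
    (sum-bijection {S′ = ≡.setoid (Fin 1)} fin (1 , ↔-id (Fin 1)) (λ _ → zero) (λ _ → ≡.refl)
      (λ {x} {y} _ → H.∙∈ (H.⁻¹∈ (proj₂ x)) (proj₂ y)) (λ { zero → (ε , H.ε∈) , ≡.refl })
      _ (λ _ → a) (λ _ → refl) (λ (h , h∈) → a-fixed h h∈))
    (A.identityʳ a)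
    where module H = Subgroup H

  transfer-transfer : (H I J : Subgroup G) → ∣ I ∣ ⊆ ∣ H ∣ → ∣ J ∣ ⊆ ∣ I ∣ →
                      (fin : Finite (Cosets H I)) (fin′ : Finite (Cosets I J)) (fin″ : Finite (Cosets H J)) →
                      ∀ {a} → FixedBy J a → transfer H I fin (transfer I J fin′ a) ≈ transfer H J fin″ a
  transfer-transfer H I J I⊆H J⊆I (n , E) (n′ , E′) fin″ {a} a-fixed = sym (trans
    (sum-fibres fin″ (λ _ → n′) φ (λ {k} {k′} {x} {x′} → φ-inj {k} {k′} {x} {x′}) φ-surj _ (fixed-coset J a-fixed))
    (sum-cong {n} (λ k → trans (sum-cong {n′} (λ x → ·-assoc _ _ _)) (sym (hom-sum {A = abelianGroup} {B = abelianGroup} (act _) {n′} _)))))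
    where
    module H = Subgroup H
    module I = Subgroup I
    module J = Subgroup J
    module E = Inverse E
    module E′ = Inverse E′
    φ : Fin n → Fin n′ → Σ Carrier ∣ H ∣
    φ k x = proj₁ (E.to k) ∙ proj₁ (E′.to x) , H.∙∈ (proj₂ (E.to k)) (I⊆H (proj₂ (E′.to x)))
    quotient : ∀ h x h′ x′ → x ∙ ((h ∙ x) ⁻¹ ∙ (h′ ∙ x′)) ∙ x′ ⁻¹ ≈ᴳ h ⁻¹ ∙ h′
    quotient h x h′ x′ = begin
      x ∙ ((h ∙ x) ⁻¹ ∙ (h′ ∙ x′)) ∙ x′ ⁻¹     ≈⟨ ∙-congʳ (∙-congˡ (∙-congʳ (⁻¹-anti-homo-∙ h x))) ⟩
      x ∙ (x ⁻¹ ∙ h ⁻¹ ∙ (h′ ∙ x′)) ∙ x′ ⁻¹    ≈⟨ ∙-congʳ (∙-congˡ (assoc _ _ _)) ⟩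
      x ∙ (x ⁻¹ ∙ (h ⁻¹ ∙ (h′ ∙ x′))) ∙ x′ ⁻¹  ≈⟨ ∙-congʳ (\\-leftDividesˡ x _) ⟩
      h ⁻¹ ∙ (h′ ∙ x′) ∙ x′ ⁻¹                 ≈⟨ assoc _ _ _ ⟩
      h ⁻¹ ∙ (h′ ∙ x′ ∙ x′ ⁻¹)                 ≈⟨ ∙-congˡ (transᴳ (assoc _ _ _) (transᴳ (∙-congˡ (inverseʳ x′)) (identityʳ h′))) ⟩
      h ⁻¹ ∙ h′                                ∎
      where open SetoidReasoning (Group.setoid group)
    φ-inj : ∀ {k k′ x x′} → Setoid._≈_ (Cosets H J) (φ k x) (φ k′ x′) → (k , x) ≡ (k′ , x′)
    φ-inj {k} {k′} {x} {x′} p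
      with ≡.trans (≡.sym (E.strictlyInverseʳ k)) (≡.trans (E.from-cong
             (I.resp (quotient _ _ _ _) (I.∙∈ (I.∙∈ (proj₂ (E′.to x)) (J⊆I p)) (I.⁻¹∈ (proj₂ (E′.to x′))))))
             (E.strictlyInverseʳ k′))
    ... | ≡.refl = ≡.cong (k ,_) (≡.trans (≡.sym (E′.strictlyInverseʳ x))
                     (≡.trans (E′.from-cong (J.resp (translate-quotient _ _ _) p)) (E′.strictlyInverseʳ x′)))
    φ-surj : ∀ z → ∃ λ k → ∃ λ x → Setoid._≈_ (Cosets H J) (φ k x) z
    φ-surj z = k , E′.from y ,
      J.resp (symᴳ (transᴳ (∙-congʳ (⁻¹-anti-homo-∙ _ _)) (assoc _ _ _))) (E′.strictlyInverseˡ y)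
      where
      k : Fin n
      k = E.from z
      y : Σ Carrier ∣ I ∣
      y = proj₁ (E.to k) ⁻¹ ∙ proj₁ z , E.strictlyInverseˡ z

  transfer-conj : ∀ g (H I : Subgroup G) (fin : Finite (Cosets H I)) (fin′ : Finite (Cosets (conj g H) (conj g I))) →
                  ∀ {a} → FixedBy I a → FixedBy (conj g I) (g · a) →
                  g · transfer H I fin a ≈ transfer (conj g H) (conj g I) fin′ (g · a)
  transfer-conj g H I fin fin′ {a} a-fixed ga-fixed = trans (hom-sum {A = abelianGroup} {B = abelianGroup} (act g) {proj₁ fin} _)
    (sum-bijection fin fin′ (λ (h , h∈) → κ (g ⁻¹) h , H.resp (symᴳ (κ-invʳ g h)) h∈)
      (λ p → I.resp (symᴳ (quotient _ _)) p) (λ p → I.resp (quotient _ _) p)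
      (λ (z , z∈) → (κ g z , z∈) ,
        conj-I.resp (symᴳ (transᴳ (∙-congʳ (⁻¹-cong (κ-invˡ g z))) (inverseˡ z))) conj-I.ε∈)
      _ _ (fixed-coset (conj g I) ga-fixed)
      (λ (h , _) → trans (sym (·-assoc g h a)) (trans (·-cong (symᴳ (κ-∙ʳ h)) refl) (·-assoc _ g a))))
    where
    module H = Subgroup H
    module I = Subgroup I
    module conj-I = Subgroup (conj g I)
    quotient : ∀ x y → κ g (κ (g ⁻¹) x ⁻¹ ∙ κ (g ⁻¹) y) ≈ᴳ x ⁻¹ ∙ y
    quotient x y = transᴳ (κ-cong reflᴳ (transᴳ (∙-congʳ (symᴳ (κ-⁻¹ (g ⁻¹) x))) (symᴳ (κ-∙ (g ⁻¹) _ _)))) (κ-invʳ g _)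
    κ-∙ʳ : ∀ h → κ (g ⁻¹) h ∙ g ≈ᴳ g ∙ h
    κ-∙ʳ h = transᴳ (//-rightDividesˡ g _) (∙-congʳ (⁻¹-involutive g))

  conj-fixed : ∀ g (H : Subgroup G) {a} → FixedBy H a → FixedBy (conj g H) (g · a)
  conj-fixed g H {a} a-fixed h h∈ = begin
    h · g · a          ≈⟨ ·-assoc h g a ⟨
    (h ∙ g) · a        ≈⟨ ·-cong (symᴳ (∙-κ g h)) refl ⟩
    (g ∙ κ g h) · a    ≈⟨ ·-assoc g _ a ⟩
    g · κ g h · a      ≈⟨ ·-cong reflᴳ (a-fixed _ h∈) ⟩
    g · a              ∎
    where open SetoidReasoning setoid

  transfer-mackey : (H I J : Subgroup G) → ∣ I ∣ ⊆ ∣ H ∣ → (fin : Finite (Cosets H J))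
                    (reps : Finite (DoubleCosets I H J)) (fin′ : ∀ h → h ∈ ∣ H ∣ → Finite (Cosets I (I ∩ₛ conj h J))) →
                    ∀ {a} → FixedBy J a →
                    transfer H J fin a ≈ sumOver reps λ (h , h∈H) → transfer I (I ∩ₛ conj h J) (fin′ h h∈H) (h · a)
  transfer-mackey H I J I⊆H fin (d , D) fin′ {a} a-fixed = trans
    (sum-fibres fin n φ (λ {k} {k′} {x} {x′} → φ-inj {k} {k′} {x} {x′}) φ-surj _ (fixed-coset J a-fixed))
    (sum-cong {d} (λ k → sum-cong {n k} (λ x → ·-assoc _ _ _)))
    where
    module H = Subgroup H
    module I = Subgroup I
    module J = Subgroup J
    module D = Inverse D
    rep : Fin d → Carrier
    rep k = proj₁ (D.to k)
    n : Fin d → ℕ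
    n k = proj₁ (fin′ (rep k) (proj₂ (D.to k)))
    module E k = Inverse (proj₂ (fin′ (rep k) (proj₂ (D.to k))))
    φ : ∀ k → Fin (n k) → Σ Carrier ∣ H ∣
    φ k x = proj₁ (E.to k x) ∙ rep k , H.∙∈ (I⊆H (proj₂ (E.to k x))) (proj₂ (D.to k))
    quotient : ∀ x h z → (x ∙ h) ⁻¹ ∙ z ≈ᴳ h ⁻¹ ∙ (x ⁻¹ ∙ z)
    quotient x h z = transᴳ (∙-congʳ (⁻¹-anti-homo-∙ x h)) (assoc _ _ _)
    recover : ∀ x h x′ h′ → h′ ≈ᴳ x′ ⁻¹ ∙ x ∙ h ∙ ((x ∙ h) ⁻¹ ∙ (x′ ∙ h′))
    recover x h x′ h′ = symᴳ (begin
      x′ ⁻¹ ∙ x ∙ h ∙ ((x ∙ h) ⁻¹ ∙ (x′ ∙ h′))    ≈⟨ ∙-congʳ (assoc _ _ _) ⟩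
      x′ ⁻¹ ∙ (x ∙ h) ∙ ((x ∙ h) ⁻¹ ∙ (x′ ∙ h′))  ≈⟨ assoc _ _ _ ⟩
      x′ ⁻¹ ∙ (x ∙ h ∙ ((x ∙ h) ⁻¹ ∙ (x′ ∙ h′)))  ≈⟨ ∙-congˡ (\\-leftDividesˡ (x ∙ h) _) ⟩
      x′ ⁻¹ ∙ (x′ ∙ h′)                           ≈⟨ \\-leftDividesʳ x′ h′ ⟩
      h′                                          ∎)
      where open SetoidReasoning (Group.setoid group)
    φ-inj : ∀ {k k′ x x′} → Setoid._≈_ (Cosets H J) (φ k x) (φ k′ x′) → (k , x) ≡ (k′ , x′)
    φ-inj {k} {k′} {x} {x′} p
      with ≡.trans (≡.sym (D.strictlyInverseʳ k)) (≡.trans (D.from-cong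
             (_ , _ , I.∙∈ (I.⁻¹∈ (proj₂ (E.to k′ x′))) (proj₂ (E.to k x)) , p , recover _ _ _ _))
             (D.strictlyInverseʳ k′))
    ... | ≡.refl = ≡.cong (k ,_) (≡.trans (≡.sym (E.strictlyInverseʳ k x)) (≡.trans (E.from-cong k
                     (I.∙∈ (I.⁻¹∈ (proj₂ (E.to k x))) (proj₂ (E.to k x′)) ,
                      J.resp (transᴳ (quotient _ _ _) (transᴳ (∙-congˡ (symᴳ (assoc _ _ _))) (symᴳ (assoc _ _ _)))) p))
                     (E.strictlyInverseʳ k x′)))
    φ-surj : ∀ z → ∃ λ k → ∃ λ x → Setoid._≈_ (Cosets H J) (φ k x) z
    φ-surj z with D.from z | D.strictlyInverseˡ z
    ... | k | i , j , i∈ , j∈ , eq = k , E.from k (i , i∈) ,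
      J.resp rearranged (J.∙∈ (proj₂ (E.strictlyInverseˡ k (i , i∈))) j∈)
      where
      x = proj₁ (E.to k (E.from k (i , i∈)))
      h = rep k
      open SetoidReasoning (Group.setoid group)
      rearranged : κ h (x ⁻¹ ∙ i) ∙ j ≈ᴳ (x ∙ h) ⁻¹ ∙ proj₁ z
      rearranged = begin
        h ⁻¹ ∙ (x ⁻¹ ∙ i) ∙ h ∙ j      ≈⟨ assoc _ _ _ ⟩
        h ⁻¹ ∙ (x ⁻¹ ∙ i) ∙ (h ∙ j)    ≈⟨ assoc _ _ _ ⟩
        h ⁻¹ ∙ (x ⁻¹ ∙ i ∙ (h ∙ j))    ≈⟨ ∙-congˡ (assoc _ _ _) ⟩
        h ⁻¹ ∙ (x ⁻¹ ∙ (i ∙ (h ∙ j)))  ≈⟨ ∙-congˡ (∙-congˡ (assoc _ _ _)) ⟨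
        h ⁻¹ ∙ (x ⁻¹ ∙ (i ∙ h ∙ j))    ≈⟨ ∙-congˡ (∙-congˡ eq) ⟨
        h ⁻¹ ∙ (x ⁻¹ ∙ proj₁ z)        ≈⟨ quotient x h _ ⟨
        (x ∙ h) ⁻¹ ∙ proj₁ z           ∎

module _ {ℓ} {m : Level} {G : TopologicalGroup ℓ} (𝔐 : MackeySystem G)
         (fin : IFinite (MackeySystem.subgroupSystem 𝔐)) where
  open MackeySystem 𝔐
  open TopologicalGroup G using () renaming (refl to reflᴳ)

  _⁎ : DiscreteModule m G → MackeyFunctor m 𝔐
  A ⁎ = record
    { val        = λ H → fixedPoints A (proj₁ H)
    ; castHom    = λ {H} {H′} e → mkHom {A = fixedPoints A (proj₁ H)} {B = fixedPoints A (proj₁ H′)}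
                     (λ (a , a-fixed) → a , λ h h∈ → a-fixed h (proj₂ e h∈)) id (λ _ _ → refl)
    ; resHom     = λ {H} {I} p → mkHom {A = fixedPoints A (proj₁ H)} {B = fixedPoints A (proj₁ I)}
                     (λ (a , a-fixed) → a , λ h h∈ → a-fixed h (R.below p h∈)) id (λ _ _ → refl)
    ; indHom     = λ {H} {I} q → transferHom A (proj₁ H) (proj₁ I) (fin q)
    ; conHom     = λ g H → mkHom {A = fixedPoints A (proj₁ H)} {B = fixedPoints A (conj g (proj₁ H))}
                     (λ (a , a-fixed) → g · a , conj-fixed A g (proj₁ H) a-fixed) (·-cong reflᴳ) (λ _ _ → ·-distrib g _ _)
    ; cast-id    = λ _ _ → refl
    ; cast-trans = λ _ _ _ _ → refl
    ; res-cast   = λ _ _ _ _ _ → refl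
    ; ind-cast   = λ {H} {H′} {I} {I′} e e′ q q′ (a , a-fixed) →
                     transfer-cast A (proj₁ H) (proj₁ H′) (proj₁ I) (proj₁ I′) (fin q) (fin q′) e e′ a-fixed
    ; con-cast   = λ eq _ _ _ → ·-cong eq refl
    ; res-id     = λ _ _ → refl
    ; ind-id     = λ {H} q (a , a-fixed) → transfer-self A (proj₁ H) (fin q) a-fixed
    ; con-id     = λ {h} h∈ _ (a , a-fixed) → a-fixed h h∈
    ; res-res    = λ _ _ _ → refl
    ; ind-ind    = λ {H} {I} {J} q q′ (a , a-fixed) → transfer-transfer A (proj₁ H) (proj₁ I) (proj₁ J)
                     (I.below q) (I.below q′) (fin q) (fin q′) (fin (I.trans q q′)) a-fixed
    ; con-con    = λ g g′ _ (a , _) → sym (·-assoc g′ g a)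
    ; con-res    = λ _ _ _ → refl
    ; con-ind    = λ g {H} {I} q (a , a-fixed) → transfer-conj A g (proj₁ H) (proj₁ I) (fin q) (fin (I.conj-⊆ g q))
                     a-fixed (conj-fixed A g (proj₁ I) a-fixed)
    ; mackey     = λ {H} {I} {J} p q reps (a , a-fixed) → trans
                     (transfer-mackey A (proj₁ H) (proj₁ I) (proj₁ J) (R.below p) (fin q) reps
                       (λ h h∈ → fin (I∩ʰJ∈i p q h∈)) a-fixed)
                     (sym (hom-sum {A = fixedPoints A (proj₁ I)} {B = abelianGroup}
                       (mkHom {A = fixedPoints A (proj₁ I)} {B = abelianGroup} proj₁ id (λ _ _ → refl)) {proj₁ reps} _))
    } where open DiscreteModule A

  fixedPointsMap : {A B : DiscreteModule m G} → ModuleMorphism A B → MackeyMorphism m 𝔐 (A ⁎) (B ⁎)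
  fixedPointsMap {A} {B} f = record
    { hom     = λ H → mkHom {A = fixedPoints A (proj₁ H)} {B = fixedPoints B (proj₁ H)}
                  (λ (a , a-fixed) → ⟦ a ⟧ , λ h h∈ → B.trans (B.sym (equivariant h a)) (⟦⟧-cong (a-fixed h h∈)))
                  ⟦⟧-cong (λ _ _ → homo _ _)
    ; hom-res = λ _ _ → B.refl
    ; hom-ind = λ q _ → B.trans (hom-sum {A = DiscreteModule.abelianGroup A} {B = B.abelianGroup} hom {proj₁ (fin q)} _)
                          (FiniteSum.sum-cong B.abelianGroup {proj₁ (fin q)} (λ _ → equivariant _ _))
    ; hom-con = λ g _ → equivariant g _
    }
    where
    open ModuleMorphism f
    module B = DiscreteModule B

  fixedPointsFunctor : Functor (Mod m G) (Mack m 𝔐)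
  fixedPointsFunctor = record
    { F₀     = _⁎
    ; F₁     = fixedPointsMap
    ; F-cong = λ p (a , _) → p a
    ; F-id   = λ {A} _ → DiscreteModule.refl A
    ; F-∙    = λ {_} {_} {C} _ → DiscreteModule.refl C
    }

record DescentBasis {ℓ} {G : TopologicalGroup ℓ} (𝔐 : MackeySystem G) : Set (lsuc (lsuc ℓ)) where
  open TopologicalGroup G using (IsOpen)
  open MackeySystem 𝔐
  field
    𝒰          : Pred 𝔖ᵇ (lsuc ℓ)
    𝒰-resp     : ∀ {U V} → ⟪ U ⟫ ≐ ⟪ V ⟫ → U ∈ 𝒰 → V ∈ 𝒰
    𝒰-open     : ∀ {U} → U ∈ 𝒰 → IsOpen ⟪ U ⟫
    𝒰-normal   : ∀ {U} → U ∈ 𝒰 → IsNormal (proj₁ U)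
    𝒰-nonempty : ∃ 𝒰
    𝒰-filtered : ∀ {U V} → U ∈ 𝒰 → V ∈ 𝒰 → ∃ λ W → W ∈ 𝒰 × ⟪ W ⟫ ⊆ (⟪ U ⟫ ∩ ⟪ V ⟫)
    𝒰⊆r        : ∀ {H U} → U ∈ 𝒰 → ⟪ U ⟫ ⊆ ⟪ H ⟫ → U ∈ r H
    𝒰-below    : ∀ H → ∃ λ U → U ∈ 𝒰 × ⟪ U ⟫ ⊆ ⟪ H ⟫

IsNeighbourhood : ∀ {ℓ} (G : TopologicalGroup ℓ) → TopologicalGroup.Carrier G → Pred (TopologicalGroup.Carrier G) ℓ → Set (lsuc ℓ)
IsNeighbourhood G x N = ∃ λ O → IsOpen O × x ∈ O × O ⊆ N
  where open TopologicalGroup G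

IsNeighbourhoodBasis : ∀ {ℓ} {G : TopologicalGroup ℓ} {𝔐 : MackeySystem G} → DescentBasis 𝔐 → Set (lsuc ℓ)
IsNeighbourhoodBasis {G = G} {𝔐} 𝔘 =
  (∀ {U} → U ∈ 𝒰 → IsNeighbourhood G ε ⟪ U ⟫) ×
  (∀ N → IsNeighbourhood G ε N → ∃ λ U → U ∈ 𝒰 × ⟪ U ⟫ ⊆ N)
  where
  open TopologicalGroup G using (ε)
  open MackeySystem 𝔐
  open DescentBasis 𝔘

module MackeyFunctorProperties {ℓ} {m : Level} {G : TopologicalGroup ℓ} {𝔐 : MackeySystem G} (Φ : MackeyFunctor m 𝔐) where
  open MackeySystem 𝔐
  open MackeyFunctor Φ
  open TopologicalGroup G using (_⁻¹; _∙_) renaming (Carrier to ∣G∣; _≈_ to _≈ᴳ_; refl to reflᴳ)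
  private
    module Val H = AbelianGroup (val H)

  cast-cong : ∀ {H H′} (e : ⟪ H ⟫ ≐ ⟪ H′ ⟫) {a b : Elt H} → a ≈ b → cast {H} {H′} e a ≈ cast {H} {H′} e b
  cast-cong {H} {H′} e = GroupHomomorphism.⟦⟧-cong (castHom {H} {H′} e)

  res-cong : ∀ {H I} (p : I ∈ r H) {a b : Elt H} → a ≈ b → res p a ≈ res p b
  res-cong p = GroupHomomorphism.⟦⟧-cong (resHom p)

  con-cong : ∀ g {H} {a b : Elt H} → a ≈ b → con g a ≈ con g b
  con-cong g {H} = GroupHomomorphism.⟦⟧-cong (conHom g H)

  cast-res : ∀ {H I I′} (e : ⟪ I ⟫ ≐ ⟪ I′ ⟫) (p : I ∈ r H) (p′ : I′ ∈ r H) (a : Elt H) →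
             cast {I} {I′} e (res p a) ≈ res p′ a
  cast-res {H} {I} {I′} e p p′ a = Val.trans I′ (res-cast {H} {H} {I} {I′} ≐-refl e p p′ a) (res-cong p′ (cast-id {H} ≐-refl a))

  res-irrelevant : ∀ {H I} (p p′ : I ∈ r H) (a : Elt H) → res p a ≈ res p′ a
  res-irrelevant {H} {I} p p′ a = Val.trans I (Val.sym I (cast-id {I} ≐-refl _)) (cast-res {H} {I} {I} ≐-refl p p′ a)

  ind≈cast : ∀ {H I} (q : I ∈ i H) (e : ⟪ I ⟫ ≐ ⟪ H ⟫) (a : Elt I) → ind q a ≈ cast {I} {H} e a
  ind≈cast {H} {I} q e a = Val.trans H (Val.sym H (cast-id {H} ≐-refl _))
    (Val.trans H (ind-cast {H} {H} {I} {H} ≐-refl e q I.self a) (ind-id I.self _))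

  con-≈ : ∀ {g g′ H} (e : ⟪ conjᵇ g H ⟫ ≐ ⟪ conjᵇ g′ H ⟫) → g ≈ᴳ g′ → (a : Elt H) →
          cast {conjᵇ g H} {conjᵇ g′ H} e (con g a) ≈ con g′ a
  con-≈ {g} {g′} {H} e eq a = Val.trans (conjᵇ g′ H) (con-cast {g} {g′} {H} {H} eq ≐-refl e a) (con-cong g′ (cast-id {H} ≐-refl a))

  -- con_g on Φ(U), for U with gUg⁻¹ = U
  act : ∀ {U} → IsNormal (proj₁ U) → ∣G∣ → Elt U → Elt U
  act {U} N g a = cast {conjᵇ g U} {U} (N g) (con g a)

  actHom : ∀ {U} → IsNormal (proj₁ U) → ∣G∣ → AbHom (val U) (val U)
  actHom {U} N g = _∘ₕ_ {A = val U} {B = val (conjᵇ g U)} {C = val U} (castHom {conjᵇ g U} {U} (N g)) (conHom g U)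

  res-act : ∀ {H U} (N : IsNormal (proj₁ U)) (p : U ∈ r H) g (e : ⟪ conjᵇ g H ⟫ ≐ ⟪ H ⟫) (a : Elt H) →
            act {U} N g (res p a) ≈ res p (cast {conjᵇ g H} {H} e (con g a))
  res-act {H} {U} N p g e a = Val.trans U
    (cast-cong {conjᵇ g U} {U} (N g) (con-res g p a))
    (res-cast {conjᵇ g H} {H} {conjᵇ g U} {U} e (N g) (R.conj-⊆ g p) p (con g a))

  res-invariant : ∀ {H U} (N : IsNormal (proj₁ U)) (p : U ∈ r H) {h} → h ∈ ⟪ H ⟫ → (a : Elt H) →
                  act {U} N h (res p a) ≈ res p a
  res-invariant {H} {U} N p {h} h∈ a = Val.trans U (res-act {H} {U} N p h e a) (res-cong p (con-id {h} {H} h∈ e a))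
    where e = conj-self (proj₁ H) h∈

  act-cong : ∀ {U} (N : IsNormal (proj₁ U)) {g g′} {a b : Elt U} → g ≈ᴳ g′ → a ≈ b → act {U} N g a ≈ act {U} N g′ b
  act-cong {U} N {g} {g′} {a} {b} eq p = begin
    act {U} N g a                                          ≈⟨ cast-cong {conjᵇ g U} {U} (N g) (con-cong g p) ⟩
    act {U} N g b                                          ≈⟨ cast-trans {conjᵇ g U} {conjᵇ g′ U} {U} e (N g′) (N g) _ ⟨
    cast {conjᵇ g′ U} {U} (N g′) (cast {conjᵇ g U} {conjᵇ g′ U} e (con g b))
                                                           ≈⟨ cast-cong {conjᵇ g′ U} {U} (N g′) (con-≈ {g} {g′} {U} e eq b) ⟩
    act {U} N g′ b                                         ∎
    where
    open SetoidReasoning (Val.setoid U)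
    e : ⟪ conjᵇ g U ⟫ ≐ ⟪ conjᵇ g′ U ⟫
    e = conj-cong (proj₁ U) (proj₁ U) eq ≐-refl

  act-∙ : ∀ {U} (N : IsNormal (proj₁ U)) g g′ (a : Elt U) → act {U} N (g′ ∙ g) a ≈ act {U} N g′ (act {U} N g a)
  act-∙ {U} N g g′ a = begin
    act {U} N (g′ ∙ g) a
      ≈⟨ cast-cong {conjᵇ (g′ ∙ g) U} {U} (N (g′ ∙ g)) (con-con g g′ {U} e₁ a) ⟨
    cast {conjᵇ (g′ ∙ g) U} {U} (N (g′ ∙ g)) (cast {conjᵇ g′ (conjᵇ g U)} {conjᵇ (g′ ∙ g) U} e₁ (con g′ (con g a)))
      ≈⟨ cast-trans {conjᵇ g′ (conjᵇ g U)} {conjᵇ (g′ ∙ g) U} {U} e₁ (N (g′ ∙ g)) e₃ _ ⟩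
    cast {conjᵇ g′ (conjᵇ g U)} {U} e₃ (con g′ (con g a))
      ≈⟨ cast-trans {conjᵇ g′ (conjᵇ g U)} {conjᵇ g′ U} {U} e₂ (N g′) e₃ _ ⟨
    cast {conjᵇ g′ U} {U} (N g′) (cast {conjᵇ g′ (conjᵇ g U)} {conjᵇ g′ U} e₂ (con g′ (con g a)))
      ≈⟨ cast-cong {conjᵇ g′ U} {U} (N g′) (con-cast {g′} {g′} {conjᵇ g U} {U} reflᴳ (N g) e₂ (con g a)) ⟩
    act {U} N g′ (act {U} N g a) ∎
    where
    open SetoidReasoning (Val.setoid U)
    e₁ : ⟪ conjᵇ g′ (conjᵇ g U) ⟫ ≐ ⟪ conjᵇ (g′ ∙ g) U ⟫
    e₁ = conj-conj (proj₁ U) g g′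
    e₂ : ⟪ conjᵇ g′ (conjᵇ g U) ⟫ ≐ ⟪ conjᵇ g′ U ⟫
    e₂ = conj-cong (conj g (proj₁ U)) (proj₁ U) reflᴳ (N g)
    e₃ : ⟪ conjᵇ g′ (conjᵇ g U) ⟫ ≐ ⟪ U ⟫
    e₃ = ≐-trans e₂ (N g′)

  -- The Mackey formula for a normal subgroup U ≤ I of G, where U\H/I = H/I.
  res-ind-normal : ∀ {H I U} (N : IsNormal (proj₁ U)) (p : U ∈ r H) (p′ : U ∈ r I) (q : I ∈ i H)
                   (fin : Finite (Cosets (proj₁ H) (proj₁ I))) (a : Elt I) →
                   res p (ind q a) ≈ FiniteSum.sumOver (val U) fin (λ (h , _) → act {U} N h (res p′ a))
  res-ind-normal {H} {I} {U} N p p′ q (n , E) a = Val.trans U (mackey p q (n , D) a)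
    (FiniteSum.sum-cong (val U) {n} (λ k → term (E.to k)))
    where
    module E = Inverse E
    module H = Subgroup (proj₁ H)
    module Iₛ = Subgroup (proj₁ I)
    module U = Subgroup (proj₁ U)
    module G = TopologicalGroup G
    open Conjugation G.group
    open GroupProperties G.group using (\\-leftDividesˡ)
    module C = Setoid (Cosets (proj₁ H) (proj₁ I))
    module DC = Setoid (DoubleCosets (proj₁ U) (proj₁ H) (proj₁ I))

    coset⇒double : ∀ {x y} → x C.≈ y → x DC.≈ y
    coset⇒double {x , _} {y , _} p = G.ε , x ⁻¹ ∙ y , U.ε∈ , p ,
      G.sym (G.trans (G.∙-congʳ (G.identityˡ x)) (\\-leftDividesˡ x y))

    double⇒coset : ∀ {x y} → x DC.≈ y → x C.≈ y
    double⇒coset {x , _} {y , _} (u , j , u∈ , j∈ , eq) =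
      Iₛ.resp (G.sym (G.trans (G.∙-congˡ eq) (G.trans (G.sym (G.assoc _ _ _)) (G.∙-congʳ (G.sym (G.assoc _ _ _))))))
        (Iₛ.∙∈ (R.below p′ (proj₂ (N x) u∈)) j∈)

    D : Inverse (≡.setoid (Fin n)) (DoubleCosets (proj₁ U) (proj₁ H) (proj₁ I))
    D = record
      { to        = E.to
      ; from      = E.from
      ; to-cong   = λ {k} {k′} eq → coset⇒double {E.to k} {E.to k′} (E.to-cong eq)
      ; from-cong = λ {x} {y} eq → E.from-cong (double⇒coset {x} {y} eq)
      ; inverse   = (λ {x} {k} eq → coset⇒double {E.to k} {x} (E.inverseˡ eq)) ,
                    (λ {k} {x} eq → E.inverseʳ (double⇒coset {x} {E.to k} eq))
      }

    term : ((h , h∈) : Σ ∣G∣ ⟪ H ⟫) →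
           ind (I∩ʰJ∈i p q h∈) (cast {conjᵇ h (Iʰ∩J p q h∈)} {I∩ʰJ p q h∈} (conj-Iʰ∩J p q h∈)
             (con h (res (Iʰ∩J∈r p q h∈) a)))
           ≈ act {U} N h (res p′ a)
    term (h , h∈) = begin
      ind (I∩ʰJ∈i p q h∈) (cast {conjᵇ h K} {L} (conj-Iʰ∩J p q h∈) y)
        ≈⟨ ind≈cast {U} {L} (I∩ʰJ∈i p q h∈) e₁ _ ⟩
      cast {L} {U} e₁ (cast {conjᵇ h K} {L} (conj-Iʰ∩J p q h∈) y)
        ≈⟨ cast-trans {conjᵇ h K} {L} {U} (conj-Iʰ∩J p q h∈) e₁ e₃ y ⟩
      cast {conjᵇ h K} {U} e₃ y
        ≈⟨ cast-trans {conjᵇ h K} {conjᵇ h U} {U} e₄ (N h) e₃ y ⟨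
      cast {conjᵇ h U} {U} (N h) (cast {conjᵇ h K} {conjᵇ h U} e₄ y)
        ≈⟨ cast-cong {conjᵇ h U} {U} (N h) (con-cast {h} {h} {K} {U} reflᴳ e₂ e₄ _) ⟩
      cast {conjᵇ h U} {U} (N h) (con h (cast {K} {U} e₂ (res (Iʰ∩J∈r p q h∈) a)))
        ≈⟨ cast-cong {conjᵇ h U} {U} (N h) (con-cong h (cast-res {I} {K} {U} e₂ (Iʰ∩J∈r p q h∈) p′ a)) ⟩
      act {U} N h (res p′ a) ∎
      where
      open SetoidReasoning (Val.setoid U)
      K = Iʰ∩J p q h∈
      L = I∩ʰJ p q h∈
      y : Elt (conjᵇ h K)
      y = con h (res (Iʰ∩J∈r p q h∈) a)
      e₁ : ⟪ L ⟫ ≐ ⟪ U ⟫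
      e₁ = proj₁ , λ x∈ → x∈ , R.below p′ (proj₂ (N h) x∈)
      e₂ : ⟪ K ⟫ ≐ ⟪ U ⟫
      e₂ = (λ (x∈ , _) → proj₁ (N (h ⁻¹)) x∈) , (λ x∈ → proj₂ (N (h ⁻¹)) x∈ , R.below p′ x∈)
      e₃ : ⟪ conjᵇ h K ⟫ ≐ ⟪ U ⟫
      e₃ = ≐-trans (conj-Iʰ∩J p q h∈) e₁
      e₄ : ⟪ conjᵇ h K ⟫ ≐ ⟪ conjᵇ h U ⟫
      e₄ = conj-cong (proj₁ K) (proj₁ U) reflᴳ e₂

module _ {ℓ} {m : Level} {G : TopologicalGroup ℓ} {𝔐 : MackeySystem G} (𝔘 : DescentBasis 𝔐) where
  open MackeySystem 𝔐
  open DescentBasis 𝔘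
  private
    module G = TopologicalGroup G

  module Colimit (Φ : MackeyFunctor m 𝔐) where
    open MackeyFunctor Φ
    open MackeyFunctorProperties Φ
    private
      module Val H = AbelianGroup (val H)

    ρ : ∀ {H U} → U ∈ 𝒰 → ⟪ U ⟫ ⊆ ⟪ H ⟫ → Elt H → Elt U
    ρ u U⊆H = res (𝒰⊆r u U⊆H)

    ρ-cong : ∀ {H U} (u : U ∈ 𝒰) (U⊆H : ⟪ U ⟫ ⊆ ⟪ H ⟫) {a b : Elt H} → a ≈ b → ρ u U⊆H a ≈ ρ u U⊆H b
    ρ-cong u U⊆H = res-cong (𝒰⊆r u U⊆H)

    ρ-homo : ∀ {H U} (u : U ∈ 𝒰) (U⊆H : ⟪ U ⟫ ⊆ ⟪ H ⟫) (a b : Elt H) →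
             ρ u U⊆H (Val._∙_ H a b) ≈ Val._∙_ U (ρ u U⊆H a) (ρ u U⊆H b)
    ρ-homo u U⊆H = GroupHomomorphism.homo (resHom (𝒰⊆r u U⊆H))

    res-ρ : ∀ {H I U} (p : I ∈ r H) (u : U ∈ 𝒰) (U⊆I : ⟪ U ⟫ ⊆ ⟪ I ⟫) (U⊆H : ⟪ U ⟫ ⊆ ⟪ H ⟫) (a : Elt H) →
            ρ u U⊆I (res p a) ≈ ρ u U⊆H a
    res-ρ {U = U} p u U⊆I U⊆H a = Val.trans U (res-res p (𝒰⊆r u U⊆I) a) (res-irrelevant _ _ a)

    ρ-ρ : ∀ {H U W} (u : U ∈ 𝒰) (w : W ∈ 𝒰) (U⊆H : ⟪ U ⟫ ⊆ ⟪ H ⟫) (W⊆U : ⟪ W ⟫ ⊆ ⟪ U ⟫) (W⊆H : ⟪ W ⟫ ⊆ ⟪ H ⟫) (a : Elt H) →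
          ρ w W⊆U (ρ u U⊆H a) ≈ ρ w W⊆H a
    ρ-ρ u w U⊆H = res-ρ (𝒰⊆r u U⊆H) w

    ρ-act : ∀ {U W} (u : U ∈ 𝒰) (w : W ∈ 𝒰) (W⊆U : ⟪ W ⟫ ⊆ ⟪ U ⟫) g (a : Elt U) →
            ρ w W⊆U (act {U} (𝒰-normal u) g a) ≈ act {W} (𝒰-normal w) g (ρ w W⊆U a)
    ρ-act {U} {W} u w W⊆U g a = Val.sym W (res-act {U} {W} (𝒰-normal w) (𝒰⊆r w W⊆U) g (𝒰-normal u g) a)

    -- [U,a]
    record Germ : Set (lsuc ℓ ⊔ m) where
      constructor germ
      field
        {stage} : 𝔖ᵇ
        stage∈  : stage ∈ 𝒰
        elt     : Elt stage
    open Germ public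

    -- [U,a] = [V,b] iff a and b agree on some W ∈ 𝒰 with W ≤ U ∩ V
    infix 4 _∼_
    record _∼_ (x y : Germ) : Set (lsuc ℓ ⊔ m) where
      constructor agree
      field
        {common} : 𝔖ᵇ
        common∈  : common ∈ 𝒰
        ⊆ˡ       : ⟪ common ⟫ ⊆ ⟪ stage x ⟫
        ⊆ʳ       : ⟪ common ⟫ ⊆ ⟪ stage y ⟫
        equal    : ρ common∈ ⊆ˡ (elt x) ≈ ρ common∈ ⊆ʳ (elt y)

    same-stage : ∀ {U} (u : U ∈ 𝒰) {a b : Elt U} → a ≈ b → germ u a ∼ germ u b
    same-stage u p = agree u id id (ρ-cong u id p)

    ∼-refl : ∀ {x} → x ∼ x
    ∼-refl {germ u a} = same-stage u (AbelianGroup.refl (val _))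

    ∼-sym : ∀ {x y} → x ∼ y → y ∼ x
    ∼-sym (agree w s t p) = agree w t s (Val.sym _ p)

    ∼-trans : ∀ {x y z} → x ∼ y → y ∼ z → x ∼ z
    ∼-trans (agree {W₁} w₁ s₁ t₁ p₁) (agree {W₂} w₂ s₂ t₂ p₂) =
      let (W , w , W⊆) = 𝒰-filtered w₁ w₂
          W⊆W₁ : ⟪ W ⟫ ⊆ ⟪ W₁ ⟫
          W⊆W₁ = λ x∈ → proj₁ (W⊆ x∈)
          W⊆W₂ : ⟪ W ⟫ ⊆ ⟪ W₂ ⟫
          W⊆W₂ = λ x∈ → proj₂ (W⊆ x∈)
          open SetoidReasoning (Val.setoid W)
      in agree w (λ x∈ → s₁ (W⊆W₁ x∈)) (λ x∈ → t₂ (W⊆W₂ x∈)) (begin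
        ρ w _ _                    ≈⟨ ρ-ρ w₁ w s₁ W⊆W₁ _ _ ⟨
        ρ w W⊆W₁ (ρ w₁ s₁ _)       ≈⟨ ρ-cong w W⊆W₁ p₁ ⟩
        ρ w W⊆W₁ (ρ w₁ t₁ _)       ≈⟨ ρ-ρ w₁ w t₁ W⊆W₁ (λ x∈ → t₁ (W⊆W₁ x∈)) _ ⟩
        ρ w _ _                    ≈⟨ res-irrelevant _ _ _ ⟩
        ρ w _ _                    ≈⟨ ρ-ρ w₂ w s₂ W⊆W₂ (λ x∈ → s₂ (W⊆W₂ x∈)) _ ⟨
        ρ w W⊆W₂ (ρ w₂ s₂ _)       ≈⟨ ρ-cong w W⊆W₂ p₂ ⟩
        ρ w W⊆W₂ (ρ w₂ t₂ _)       ≈⟨ ρ-ρ w₂ w t₂ W⊆W₂ _ _ ⟩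
        ρ w _ _                    ∎)

    ∼-ρ : ∀ {U W} (u : U ∈ 𝒰) (w : W ∈ 𝒰) (W⊆U : ⟪ W ⟫ ⊆ ⟪ U ⟫) (a : Elt U) → germ u a ∼ germ w (ρ w W⊆U a)
    ∼-ρ u w W⊆U a = agree w W⊆U id (Val.sym _ (ρ-ρ w w W⊆U id W⊆U a))

    ρ-∼-ρ : ∀ {H U V} (u : U ∈ 𝒰) (v : V ∈ 𝒰) (U⊆H : ⟪ U ⟫ ⊆ ⟪ H ⟫) (V⊆H : ⟪ V ⟫ ⊆ ⟪ H ⟫) (a : Elt H) →
            germ u (ρ u U⊆H a) ∼ germ v (ρ v V⊆H a)
    ρ-∼-ρ u v U⊆H V⊆H a =
      let (W , w , W⊆) = 𝒰-filtered u v
      in agree w (λ x∈ → proj₁ (W⊆ x∈)) (λ x∈ → proj₂ (W⊆ x∈))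
           (Val.trans W (ρ-ρ u w U⊆H _ (λ x∈ → U⊆H (proj₁ (W⊆ x∈))) a)
             (Val.sym W (ρ-ρ v w V⊆H _ (λ x∈ → U⊆H (proj₁ (W⊆ x∈))) a)))

    infixl 6 _⊕_
    _⊕_ : Germ → Germ → Germ
    germ u a ⊕ germ v b =
      let (W , w , W⊆) = 𝒰-filtered u v
      in germ w (Val._∙_ W (ρ w (λ x∈ → proj₁ (W⊆ x∈)) a) (ρ w (λ x∈ → proj₂ (W⊆ x∈)) b))

    ⊕-at : ∀ {U V W} (u : U ∈ 𝒰) (v : V ∈ 𝒰) (w : W ∈ 𝒰) (W⊆U : ⟪ W ⟫ ⊆ ⟪ U ⟫) (W⊆V : ⟪ W ⟫ ⊆ ⟪ V ⟫) (a : Elt U) (b : Elt V) →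
           germ u a ⊕ germ v b ∼ germ w (Val._∙_ W (ρ w W⊆U a) (ρ w W⊆V b))
    ⊕-at {U} {V} {W} u v w W⊆U W⊆V a b =
      let (X , x , X⊆) = 𝒰-filtered u v
          (Y , y , Y⊆) = 𝒰-filtered x w
          Y⊆U : ⟪ Y ⟫ ⊆ ⟪ U ⟫
          Y⊆U = λ y∈ → W⊆U (proj₂ (Y⊆ y∈))
          Y⊆V : ⟪ Y ⟫ ⊆ ⟪ V ⟫
          Y⊆V = λ y∈ → W⊆V (proj₂ (Y⊆ y∈))
      in agree y (λ y∈ → proj₁ (Y⊆ y∈)) (λ y∈ → proj₂ (Y⊆ y∈)) (Val.trans Y
           (Val.trans Y (ρ-homo y _ _ _) (Val.∙-cong Y (ρ-ρ x y _ _ Y⊆U a) (ρ-ρ x y _ _ Y⊆V b)))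
           (Val.sym Y (Val.trans Y (ρ-homo y _ _ _) (Val.∙-cong Y (ρ-ρ w y W⊆U _ Y⊆U a) (ρ-ρ w y W⊆V _ Y⊆V b)))))

    ⊕-same-stage : ∀ {U} (u : U ∈ 𝒰) (a b : Elt U) → germ u a ⊕ germ u b ∼ germ u (Val._∙_ U a b)
    ⊕-same-stage {U} u a b = ∼-trans (⊕-at u u u id id a b)
      (same-stage u (Val.∙-cong U (res-id _ a) (res-id _ b)))

    ⊕-cong : ∀ {x x′ y y′} → x ∼ x′ → y ∼ y′ → x ⊕ y ∼ x′ ⊕ y′
    ⊕-cong {germ u a} {germ u′ a′} {germ v b} {germ v′ b′} (agree {W₁} w₁ s₁ t₁ p₁) (agree {W₂} w₂ s₂ t₂ p₂) =
      let (W , w , W⊆) = 𝒰-filtered w₁ w₂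
          W⊆W₁ : ⟪ W ⟫ ⊆ ⟪ W₁ ⟫
          W⊆W₁ = λ x∈ → proj₁ (W⊆ x∈)
          W⊆W₂ : ⟪ W ⟫ ⊆ ⟪ W₂ ⟫
          W⊆W₂ = λ x∈ → proj₂ (W⊆ x∈)
      in ∼-trans (⊕-at u v w (λ x∈ → s₁ (W⊆W₁ x∈)) (λ x∈ → s₂ (W⊆W₂ x∈)) a b)
           (∼-trans (same-stage w (Val.∙-cong W (lower w w₁ W⊆W₁ s₁ t₁ p₁) (lower w w₂ W⊆W₂ s₂ t₂ p₂)))
             (∼-sym (⊕-at u′ v′ w (λ x∈ → t₁ (W⊆W₁ x∈)) (λ x∈ → t₂ (W⊆W₂ x∈)) a′ b′)))
      where
      lower : ∀ {U U′ X W} {a : Elt U} {a′ : Elt U′} (w : W ∈ 𝒰) (x : X ∈ 𝒰) (W⊆X : ⟪ W ⟫ ⊆ ⟪ X ⟫)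
              (s : ⟪ X ⟫ ⊆ ⟪ U ⟫) (t : ⟪ X ⟫ ⊆ ⟪ U′ ⟫) → ρ x s a ≈ ρ x t a′ →
              ρ w (λ z∈ → s (W⊆X z∈)) a ≈ ρ w (λ z∈ → t (W⊆X z∈)) a′
      lower {W = W} w x W⊆X s t p = Val.trans W (Val.sym W (ρ-ρ x w s W⊆X _ _))
        (Val.trans W (ρ-cong w W⊆X p) (ρ-ρ x w t W⊆X _ _))

    data AtCommonStage (x y z : Germ) : Set (lsuc ℓ ⊔ m) where
      stages : ∀ {W} (w : W ∈ 𝒰) (a b c : Elt W) → x ∼ germ w a → y ∼ germ w b → z ∼ germ w c → AtCommonStage x y z

    commonStage : ∀ x y z → AtCommonStage x y z
    commonStage (germ u a) (germ v b) (germ t c) =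
      let (X , x , X⊆) = 𝒰-filtered u v
          (W , w , W⊆) = 𝒰-filtered x t
      in stages w _ _ _ (∼-ρ u w (λ z∈ → proj₁ (X⊆ (proj₁ (W⊆ z∈)))) a)
                        (∼-ρ v w (λ z∈ → proj₂ (X⊆ (proj₁ (W⊆ z∈)))) b)
                        (∼-ρ t w (λ z∈ → proj₂ (W⊆ z∈)) c)

    0ᴳ : Germ
    0ᴳ = germ (proj₂ 𝒰-nonempty) (Val.ε _)

    ∼-0 : ∀ {U} (u : U ∈ 𝒰) → germ u (Val.ε U) ∼ 0ᴳ
    ∼-0 u =
      let (W , w , W⊆) = 𝒰-filtered u (proj₂ 𝒰-nonempty)
      in agree w (λ x∈ → proj₁ (W⊆ x∈)) (λ x∈ → proj₂ (W⊆ x∈))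
           (Val.trans W (GroupHomomorphism.ε-homo (resHom _)) (Val.sym W (GroupHomomorphism.ε-homo (resHom _))))

    ⊖_ : Germ → Germ
    ⊖ germ u a = germ u (Val._⁻¹ _ a)

    ⊕-comm : ∀ x y → x ⊕ y ∼ y ⊕ x
    ⊕-comm x y with commonStage x y y
    ... | stages {W} w a b _ p q _ = ∼-trans (⊕-cong p q) (∼-trans (⊕-same-stage w a b)
            (∼-trans (same-stage w (Val.comm W a b)) (∼-sym (∼-trans (⊕-cong q p) (⊕-same-stage w b a)))))

    ⊕-assoc : ∀ x y z → (x ⊕ y) ⊕ z ∼ x ⊕ (y ⊕ z)
    ⊕-assoc x y z with commonStage x y z
    ... | stages {W} w a b c p q s =
      ∼-trans (⊕-cong (∼-trans (⊕-cong p q) (⊕-same-stage w a b)) s)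
        (∼-trans (⊕-same-stage w _ c)
          (∼-trans (same-stage w (Val.assoc W a b c))
            (∼-sym (∼-trans (⊕-cong p (∼-trans (⊕-cong q s) (⊕-same-stage w b c))) (⊕-same-stage w a _)))))

    ⊕-identityˡ : ∀ x → 0ᴳ ⊕ x ∼ x
    ⊕-identityˡ (germ {U} u a) = ∼-trans (⊕-cong (∼-sym (∼-0 u)) ∼-refl)
      (∼-trans (⊕-same-stage u _ a) (same-stage u (Val.identityˡ U a)))

    ⊕-inverseˡ : ∀ x → (⊖ x) ⊕ x ∼ 0ᴳ
    ⊕-inverseˡ (germ {U} u a) = ∼-trans (⊕-same-stage u _ a) (∼-trans (same-stage u (Val.inverseˡ U a)) (∼-0 u))

    ⊖-cong : ∀ {x y} → x ∼ y → ⊖ x ∼ ⊖ y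
    ⊖-cong (agree {W} w s t p) = agree w s t (Val.trans W (GroupHomomorphism.⁻¹-homo (resHom _) _)
      (Val.trans W (Val.⁻¹-cong W p) (Val.sym W (GroupHomomorphism.⁻¹-homo (resHom _) _))))

    germGroup : AbelianGroup (lsuc ℓ ⊔ m) (lsuc ℓ ⊔ m)
    germGroup .AbelianGroup.Carrier = Germ
    germGroup .AbelianGroup._≈_     = _∼_
    germGroup .AbelianGroup._∙_     = _⊕_
    germGroup .AbelianGroup.ε       = 0ᴳ
    germGroup .AbelianGroup._⁻¹     = ⊖_
    germGroup .AbelianGroup.isAbelianGroup = record
      { isGroup = record
        { isMonoid = record
          { isSemigroup = record
            { isMagma = record
              { isEquivalence = record { refl = ∼-refl ; sym = ∼-sym ; trans = ∼-trans }
              ; ∙-cong        = ⊕-cong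
              }
            ; assoc = ⊕-assoc
            }
          ; identity = ⊕-identityˡ , (λ x → ∼-trans (⊕-comm x 0ᴳ) (⊕-identityˡ x))
          }
        ; inverse = ⊕-inverseˡ , (λ x → ∼-trans (⊕-comm x (⊖ x)) (⊕-inverseˡ x))
        ; ⁻¹-cong = ⊖-cong
        }
      ; comm = ⊕-comm
      }

    germHom : ∀ {U} → U ∈ 𝒰 → AbHom (val U) germGroup
    germHom {U} u = mkHom {A = val U} {B = germGroup} (germ u) (same-stage u) (λ a b → ∼-sym (⊕-same-stage u a b))

    infixr 8 _▹_
    _▹_ : G.Carrier → Germ → Germ
    g ▹ germ {U} u a = germ u (act {U} (𝒰-normal u) g a)

    ▹-cong : ∀ {g h x y} → g G.≈ h → x ∼ y → g ▹ x ∼ h ▹ y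
    ▹-cong {g} {h} {germ {U} u a} {germ {V} v b} eq (agree {W} w s t p) = agree w s t
      (Val.trans W (ρ-act u w s g a)
        (Val.trans W (act-cong {W} (𝒰-normal w) eq p) (Val.sym W (ρ-act v w t h b))))

    ▹-distrib : ∀ g x y → g ▹ (x ⊕ y) ∼ (g ▹ x) ⊕ (g ▹ y)
    ▹-distrib g x y with commonStage x y y
    ... | stages {W} w a b _ p q _ = ∼-trans (▹-cong G.refl (∼-trans (⊕-cong p q) (⊕-same-stage w a b)))
      (∼-trans (same-stage w (GroupHomomorphism.homo (actHom {W} (𝒰-normal w) g) a b))
        (∼-sym (∼-trans (⊕-cong (▹-cong G.refl p) (▹-cong G.refl q)) (⊕-same-stage w _ _))))

    ▹-fixed : ∀ x {g} → g ∈ ⟪ stage x ⟫ → g ▹ x ∼ x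
    ▹-fixed (germ {U} u a) {g} g∈ = same-stage u (con-id {g} {U} g∈ (𝒰-normal u g) a)

    ▹-assoc : ∀ g h x → (g G.∙ h) ▹ x ∼ g ▹ h ▹ x
    ▹-assoc g h (germ {U} u a) = same-stage u (act-∙ {U} (𝒰-normal u) h g a)

    ▹-discrete : ∀ g x → ∃ λ V → G.IsOpen V × g ∈ V × (∀ {v} → v ∈ V → v ▹ x ∼ g ▹ x)
    ▹-discrete g x@(germ {U} u a) =
      let (_ , W , _ , W-open , g⁻¹∈ , g∈W , VW⊆U) =
            G.∙-continuous (𝒰-open u) (g G.⁻¹) g (U.resp (G.sym (G.inverseˡ g)) U.ε∈)
      in W , W-open , g∈W , λ {v} v∈ →
           ∼-trans (▹-cong (G.sym (\\-leftDividesˡ g v)) ∼-refl)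
             (∼-trans (▹-assoc g (g G.⁻¹ G.∙ v) x) (▹-cong G.refl (▹-fixed x (VW⊆U g⁻¹∈ v∈))))
      where
      module U = Subgroup (proj₁ U)
      open GroupProperties G.group using (\\-leftDividesˡ)

    colimitModule : DiscreteModule m G
    colimitModule = record
      { abelianGroup = germGroup
      ; _·_          = _▹_
      ; ·-cong       = ▹-cong
      ; ·-distrib    = ▹-distrib
      ; ·-id         = λ x → ▹-fixed x (Subgroup.ε∈ (proj₁ (stage x)))
      ; ·-assoc      = ▹-assoc
      ; discrete     = ▹-discrete
      }

    -- Φ(U)^{H/U}, for U ∈ 𝒰(H)
    invariants : ∀ {H U} → U ∈ 𝒰 → ⟪ U ⟫ ⊆ ⟪ H ⟫ → AbelianGroup (lsuc ℓ ⊔ m) (lsuc ℓ ⊔ m)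
    invariants {H} {U} u _ = subAbelianGroup (val U) (λ a → ∀ h → h ∈ ⟪ H ⟫ → act {U} (𝒰-normal u) h a ≈ a)
      (λ h _ → GroupHomomorphism.ε-homo (h↷ h))
      (λ p q h h∈ → Val.trans U (GroupHomomorphism.homo (h↷ h) _ _) (Val.∙-cong U (p h h∈) (q h h∈)))
      (λ p h h∈ → Val.trans U (GroupHomomorphism.⁻¹-homo (h↷ h) _) (Val.⁻¹-cong U (p h h∈)))
      where
      h↷ : G.Carrier → AbHom (val U) (val U)
      h↷ = actHom {U} (𝒰-normal u)

    resInvariants : ∀ {H U} (u : U ∈ 𝒰) (U⊆H : ⟪ U ⟫ ⊆ ⟪ H ⟫) → Elt H → AbelianGroup.Carrier (invariants {H} {U} u U⊆H)
    resInvariants {H} {U} u U⊆H a = ρ u U⊆H a , λ h h∈ → res-invariant {H} {U} (𝒰-normal u) (𝒰⊆r u U⊆H) h∈ a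

  HasGaloisDescent : Pred (MackeyFunctor m 𝔐) (lsuc ℓ ⊔ m)
  HasGaloisDescent Φ = ∀ {H U} (u : U ∈ 𝒰) (U⊆H : ⟪ U ⟫ ⊆ ⟪ H ⟫) →
    GroupMorphisms.IsGroupIsomorphism (AbelianGroup.rawGroup (val H)) (AbelianGroup.rawGroup (invariants {H} {U} u U⊆H))
      (resInvariants {H} {U} u U⊆H)
    where
    open MackeyFunctor Φ
    open Colimit Φ

  -- A = ⋃ A^U over U ∈ 𝒰
  IsUnionOfFixedPoints : Pred (DiscreteModule m G) (lsuc ℓ ⊔ m)
  IsUnionOfFixedPoints A = ∀ a → ∃ λ U → U ∈ 𝒰 × FixedBy A (proj₁ U) a

  colimitFunctor : Functor (Mack m 𝔐) (Mod m G)
  colimitFunctor = record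
    { F₀     = Colimit.colimitModule
    ; F₁     = F₁
    ; F-cong = λ {_} {Ψ} p → λ { (germ u a) → same-stage Ψ u (p a) }
    ; F-id   = λ {Φ} _ → ∼-refl Φ
    ; F-∙    = λ {_} {_} {Ω} _ → ∼-refl Ω
    }
    where
    open Colimit
    F₁ : ∀ {Φ Ψ} → MackeyMorphism m 𝔐 Φ Ψ → ModuleMorphism (colimitModule Φ) (colimitModule Ψ)
    F₁ {Φ} {Ψ} α = record
      { hom         = mkHom {A = germGroup Φ} {B = germGroup Ψ} f f-cong f-homo
      ; equivariant = λ { g (germ {U} u a) → same-stage Ψ u
          (Val.trans U (hom-cast {Φ = Φ} {Ψ = Ψ} α {conjᵇ g U} {U} (𝒰-normal u g) _)
            (MackeyFunctorProperties.cast-cong Ψ {conjᵇ g U} {U} (𝒰-normal u g) (α.hom-con g a))) }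
      }
      where
      module α = MackeyMorphism α
      module Val H = AbelianGroup (MackeyFunctor.val Ψ H)
      f : Germ Φ → Germ Ψ
      f (germ u a) = germ u α.⟦ a ⟧
      f-cong : ∀ {x y} → _∼_ Φ x y → _∼_ Ψ (f x) (f y)
      f-cong (agree {W} w s t p) = agree w s t (Val.trans W (Val.sym W (α.hom-res _ _))
        (Val.trans W (GroupHomomorphism.⟦⟧-cong (α.hom W) p) (α.hom-res _ _)))
      f-homo : ∀ x y → _∼_ Ψ (f (_⊕_ Φ x y)) (_⊕_ Ψ (f x) (f y))
      f-homo (germ u a) (germ v b) =
        let (W , w , _) = 𝒰-filtered u v
        in same-stage Ψ w (Val.trans W (GroupHomomorphism.homo (α.hom W) _ _)
             (Val.∙-cong W (α.hom-res _ a) (α.hom-res _ b)))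

  module _ (fin : IFinite subgroupSystem) where

    counit : (A : DiscreteModule m G) → ModuleMorphism (Colimit.colimitModule (_⁎ 𝔐 fin A)) A
    counit A = record
      { hom         = mkHom {A = germGroup} {B = A.abelianGroup} (λ x → proj₁ (elt x))
                        (λ x∼y → _∼_.equal x∼y) (λ _ _ → A.refl)
      ; equivariant = λ _ _ → A.refl
      }
      where
      module A = DiscreteModule A
      open Colimit (_⁎ 𝔐 fin A)

    module Unit (Φ : MackeyFunctor m 𝔐) where
      open MackeyFunctor Φ
      open MackeyFunctorProperties Φ
      open Colimit Φ
      private
        U : 𝔖ᵇ → 𝔖ᵇ
        U H = proj₁ (𝒰-below H)
        U∈ : ∀ H → U H ∈ 𝒰
        U∈ H = proj₁ (proj₂ (𝒰-below H))
        U⊆ : ∀ H → ⟪ U H ⟫ ⊆ ⟪ H ⟫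
        U⊆ H = proj₂ (proj₂ (𝒰-below H))

      η : ∀ H → Elt H → Germ
      η H a = germ (U∈ H) (ρ (U∈ H) (U⊆ H) a)

      -- η does not depend on the choice of U ∈ 𝒰(H)
      η-any : ∀ {H V} (v : V ∈ 𝒰) (V⊆H : ⟪ V ⟫ ⊆ ⟪ H ⟫) (a : Elt H) → η H a ∼ germ v (ρ v V⊆H a)
      η-any {H} v V⊆H a = ρ-∼-ρ {H} (U∈ H) v (U⊆ H) V⊆H a

      η-fixed : ∀ H (a : Elt H) → FixedBy colimitModule (proj₁ H) (η H a)
      η-fixed H a h h∈ = same-stage (U∈ H) (res-invariant {H} {U H} (𝒰-normal (U∈ H)) (𝒰⊆r (U∈ H) (U⊆ H)) h∈ a)

      η-cong : ∀ {H} {a b : Elt H} → a ≈ b → η H a ∼ η H b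
      η-cong {H} p = same-stage (U∈ H) (ρ-cong (U∈ H) (U⊆ H) p)

      η-homo : ∀ {H} (a b : Elt H) → η H (AbelianGroup._∙_ (val H) a b) ∼ η H a ⊕ η H b
      η-homo {H} a b = ∼-trans (same-stage (U∈ H) (ρ-homo (U∈ H) (U⊆ H) a b)) (∼-sym (⊕-same-stage (U∈ H) _ _))

      η-res : ∀ {H I} (p : I ∈ r H) (a : Elt H) → η I (res p a) ∼ η H a
      η-res {H} {I} p a = ∼-trans
        (same-stage (U∈ I) (res-ρ {H} {I} {U I} p (U∈ I) (U⊆ I) (λ x∈ → R.below p (U⊆ I x∈)) a))
        (∼-sym (η-any {H} {U I} (U∈ I) (λ x∈ → R.below p (U⊆ I x∈)) a))

      η-ind : ∀ {H I} (q : I ∈ i H) (a : Elt I) →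
              η H (ind q a) ∼ transfer colimitModule (proj₁ H) (proj₁ I) (fin q) (η I a)
      η-ind {H} {I} q a = ∼-trans (η-any {H} {U I} (U∈ I) UI⊆H (ind q a)) (∼-trans
        (same-stage (U∈ I) (res-ind-normal {H} {I} {U I} (𝒰-normal (U∈ I)) (𝒰⊆r (U∈ I) UI⊆H) (𝒰⊆r (U∈ I) (U⊆ I)) q (fin q) a))
        (hom-sum {A = val (U I)} {B = germGroup} (germHom (U∈ I)) {proj₁ (fin q)}
          (λ k → act {U I} (𝒰-normal (U∈ I)) (proj₁ (Inverse.to (proj₂ (fin q)) k)) (ρ (U∈ I) (U⊆ I) a))))
        where
        UI⊆H : ⟪ U I ⟫ ⊆ ⟪ H ⟫
        UI⊆H x∈ = I.below q (U⊆ I x∈)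

      η-con : ∀ g {H} (a : Elt H) → η (conjᵇ g H) (con g a) ∼ g ▹ η H a
      η-con g {H} a = ∼-trans (η-any {conjᵇ g H} {U H} (U∈ H) V⊆ (con g a))
        (same-stage (U∈ H) (AbelianGroup.sym (val (U H)) (AbelianGroup.trans (val (U H))
          (cast-cong {conjᵇ g (U H)} {U H} (𝒰-normal (U∈ H) g) (con-res g (𝒰⊆r (U∈ H) (U⊆ H)) a))
          (cast-res {conjᵇ g H} {conjᵇ g (U H)} {U H} (𝒰-normal (U∈ H) g) (R.conj-⊆ g (𝒰⊆r (U∈ H) (U⊆ H))) (𝒰⊆r (U∈ H) V⊆) (con g a)))))
        where
        V⊆ : ⟪ U H ⟫ ⊆ ⟪ conjᵇ g H ⟫
        V⊆ x∈ = U⊆ H (proj₂ (𝒰-normal (U∈ H) g) x∈)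

      unit : MackeyMorphism m 𝔐 Φ (_⁎ 𝔐 fin colimitModule)
      unit = record
        { hom     = λ H → mkHom {A = val H} {B = fixedPoints colimitModule (proj₁ H)}
                      (λ a → η H a , η-fixed H a) (λ {a} {b} → η-cong {H} {a} {b}) (η-homo {H})
        ; hom-res = λ {H} {I} → η-res {H} {I}
        ; hom-ind = λ {H} {I} → η-ind {H} {I}
        ; hom-con = λ g {H} → η-con g {H}
        }

    adjunction : Adjunction colimitFunctor (fixedPointsFunctor 𝔐 fin)
    adjunction = record
      { unit           = Unit.unit
      ; counit         = counit
      ; unit-natural   = λ {_} {Ψ} α {H} a → Colimit.same-stage Ψ (proj₁ (proj₂ (𝒰-below H)))
                           (AbelianGroup.sym (MackeyFunctor.val Ψ (proj₁ (𝒰-below H))) (MackeyMorphism.hom-res α _ a))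
      ; counit-natural = λ {_} {B} _ _ → DiscreteModule.refl B
      ; zig            = λ {Φ} → λ { (Colimit.germ {U} u a) →
                           Colimit.∼-sym Φ (Colimit.∼-ρ Φ u (proj₁ (proj₂ (𝒰-below U))) (proj₂ (proj₂ (𝒰-below U))) a) }
      ; zag            = λ {A} _ → DiscreteModule.refl A
      }

{-# OPTIONS --safe #-}
-- Bijective morphisms of Mackey functors and of discrete modules are isomorphisms, so it
-- suffices to see that η(Φ)_H and ε(A) are bijective.  If Φ has Galois descent then every
-- res_{U,H} with U ∈ 𝒰 is injective, so an equality of germs already holds at any stage
-- where both are defined.  Hence η(Φ)_H is injective, and an H-invariant germ [U,a] with
-- U ≤ H has H-invariant a, which therefore lies in the image of res_{U,H}.  The map ε(A)
-- is always injective, with image ⋃ A^U.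
module Submission where

open import Defs
open import Level using (Level)
open import Algebra.Bundles using (AbelianGroup)
open import Algebra.Morphism.Bundles using (GroupHomomorphism)
open import Algebra.Morphism.Structures using (module GroupMorphisms)
open import Data.Product.Base using (Σ; ∃; _×_; _,_; proj₁; proj₂)
open import Function.Base using (id)
import Relation.Binary.Reasoning.Setoid as SetoidReasoning
open import Relation.Unary using (Pred; _∈_; _⊆_)

fullSubcategory-iso : ∀ {o h e p} (C : Category o h e) {P : Pred (Category.Obj C) p}
                      {A B : Σ (Category.Obj C) P} {f : Category.Hom C (proj₁ A) (proj₁ B)} →
                      IsIso C f → IsIso (FullSubcategory C P) {A} {B} f
fullSubcategory-iso C f-iso = record { inverse = inverse ; inverseˡ = inverseˡ ; inverseʳ = inverseʳ }
  where open IsIso f-iso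

module _ {a b c d} (A : AbelianGroup a b) (B : AbelianGroup c d) (f : AbHom A B) where
  private
    module A = AbelianGroup A
    module B = AbelianGroup B
  open GroupHomomorphism f

  module Inverse (injective : ∀ {x y} → ⟦ x ⟧ B.≈ ⟦ y ⟧ → x A.≈ y)
                 (surjective : ∀ y → ∃ λ x → ⟦ x ⟧ B.≈ y) where

    preimage : B.Carrier → A.Carrier
    preimage y = proj₁ (surjective y)

    ⟦preimage⟧ : ∀ y → ⟦ preimage y ⟧ B.≈ y
    ⟦preimage⟧ y = proj₂ (surjective y)

    -- This reduces every law of the inverse (additivity, equivariance, compatibility with `res`,
    -- `ind` and `con`) to the corresponding law of the given morphism.
    preimage-unique : ∀ {x y} → ⟦ x ⟧ B.≈ y → preimage y A.≈ x
    preimage-unique p = injective (B.trans (⟦preimage⟧ _) (B.sym p))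

    inverseHom : AbHom B A
    inverseHom = mkHom {A = B} {B = A} preimage
      (λ p → preimage-unique (B.trans (⟦preimage⟧ _) (B.sym p)))
      (λ x y → preimage-unique (B.trans (homo _ _) (B.∙-cong (⟦preimage⟧ x) (⟦preimage⟧ y))))

module _ {ℓ} {m : Level} {G : TopologicalGroup ℓ} where

  bijective⇒module-iso : {A B : DiscreteModule m G} (f : ModuleMorphism A B)
    (let module A = DiscreteModule A) (let module B = DiscreteModule B) (let open ModuleMorphism f) →
    (∀ {x y} → ⟦ x ⟧ B.≈ ⟦ y ⟧ → x A.≈ y) → (∀ y → ∃ λ x → ⟦ x ⟧ B.≈ y) →
    IsIso (Mod m G) {A} {B} f
  bijective⇒module-iso {A} {B} f injective surjective = record
    { inverse  = record
      { hom         = inverseHom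
      ; equivariant = λ g b → preimage-unique (B.trans (equivariant g _) (B.·-cong G.refl (⟦preimage⟧ b)))
      }
    ; inverseˡ = λ _ → preimage-unique B.refl
    ; inverseʳ = ⟦preimage⟧
    }
    where
    module G = TopologicalGroup G
    module A = DiscreteModule A
    module B = DiscreteModule B
    open ModuleMorphism f
    open Inverse A.abelianGroup B.abelianGroup hom injective surjective

  bijective⇒mackey-iso : {𝔐 : MackeySystem G} {Φ Ψ : MackeyFunctor m 𝔐} (α : MackeyMorphism m 𝔐 Φ Ψ)
    (let module Φ = MackeyFunctor Φ) (let module Ψ = MackeyFunctor Ψ) (let open MackeyMorphism α) →
    (∀ H {x y : Φ.Elt H} → ⟦ x ⟧ Ψ.≈ ⟦ y ⟧ → x Φ.≈ y) → (∀ H (y : Ψ.Elt H) → ∃ λ x → ⟦ x ⟧ Ψ.≈ y) →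
    IsIso (Mack m 𝔐) {Φ} {Ψ} α
  bijective⇒mackey-iso {𝔐} {Φ} {Ψ} α injective surjective = record
    { inverse  = record
      { hom     = α⁻¹.inverseHom
      ; hom-res = λ {H} {I} p b → α⁻¹.preimage-unique I (Val.trans I (hom-res p _)
                    (GroupHomomorphism.⟦⟧-cong (Ψ.resHom p) (α⁻¹.⟦preimage⟧ H b)))
      ; hom-ind = λ {H} {I} q b → α⁻¹.preimage-unique H (Val.trans H (hom-ind q _)
                    (GroupHomomorphism.⟦⟧-cong (Ψ.indHom q) (α⁻¹.⟦preimage⟧ I b)))
      ; hom-con = λ g {H} b → α⁻¹.preimage-unique (conjᵇ g H) (Val.trans (conjᵇ g H) (hom-con g _)
                    (GroupHomomorphism.⟦⟧-cong (Ψ.conHom g H) (α⁻¹.⟦preimage⟧ H b)))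
      }
    ; inverseˡ = λ {H} _ → α⁻¹.preimage-unique H (Val.refl H)
    ; inverseʳ = λ {H} b → α⁻¹.⟦preimage⟧ H b
    }
    where
    open MackeySystem 𝔐
    open MackeyMorphism α
    module Φ = MackeyFunctor Φ
    module Ψ = MackeyFunctor Ψ
    module Val H = AbelianGroup (Ψ.val H)
    module α⁻¹ H = Inverse (Φ.val H) (Ψ.val H) (hom H) (injective H) (surjective H)

module _ {ℓ} {m : Level} {G : TopologicalGroup ℓ} {𝔐 : MackeySystem G} (𝔘 : DescentBasis 𝔐) where
  open MackeySystem 𝔐
  open DescentBasis 𝔘

  -- A germ is fixed by its own stage U, because `con` by an element of U is the identity on Φ(U).
  colimit-isUnionOfFixedPoints : (Φ : MackeyFunctor m 𝔐) → IsUnionOfFixedPoints 𝔘 (Colimit.colimitModule 𝔘 Φ)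
  colimit-isUnionOfFixedPoints Φ x = stage x , stage∈ x , λ _ → ▹-fixed x
    where open Colimit 𝔘 Φ

  -- Continuity of the action at (1, a) gives an open V containing 1 on which v · a is constantly a;
  -- any member of 𝒰 inside V then fixes a.
  neighbourhoodBasis⇒isUnionOfFixedPoints : IsNeighbourhoodBasis 𝔘 → (A : DiscreteModule m G) → IsUnionOfFixedPoints 𝔘 A
  neighbourhoodBasis⇒isUnionOfFixedPoints (_ , basis) A a =
    let (V , V-open , ε∈V , V-const) = A.discrete (TopologicalGroup.ε G) a
        (U , u , U⊆V)                = basis V (V , V-open , ε∈V , id)
    in U , u , λ h h∈ → A.trans (V-const (U⊆V h∈)) (A.·-id a)
    where module A = DiscreteModule A

  module _ (Φ : MackeyFunctor m 𝔐) (descent : HasGaloisDescent 𝔘 Φ) where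
    open MackeyFunctor Φ
    open Colimit 𝔘 Φ
    private
      module Val H = AbelianGroup (val H)
      module Descent {H U} (u : U ∈ 𝒰) (U⊆H : ⟪ U ⟫ ⊆ ⟪ H ⟫) =
        GroupMorphisms.IsGroupIsomorphism (descent {H} {U} u U⊆H)

    -- The stage X where the germs agree lies in H, so the agreement compares values of the
    -- injective map res from H to X. Taking V = W to be the chosen stage below H gives injectivity
    -- of `η`; taking H itself in 𝒰 gives `∼-injective`.
    ρ-∼-injective : ∀ {H V W} (v : V ∈ 𝒰) (w : W ∈ 𝒰) (V⊆H : ⟪ V ⟫ ⊆ ⟪ H ⟫) (W⊆H : ⟪ W ⟫ ⊆ ⟪ H ⟫) {a b : Elt H} →
                    germ v (ρ v V⊆H a) ∼ germ w (ρ w W⊆H b) → a ≈ b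
    ρ-∼-injective {H} v w V⊆H W⊆H {a} {b} (agree {X} x X⊆V X⊆W p) =
      Descent.injective {H} {X} x X⊆H (begin
        ρ x X⊆H a             ≈⟨ ρ-ρ v x V⊆H X⊆V X⊆H a ⟨
        ρ x X⊆V (ρ v V⊆H a)   ≈⟨ p ⟩
        ρ x X⊆W (ρ w W⊆H b)   ≈⟨ ρ-ρ w x W⊆H X⊆W X⊆H b ⟩
        ρ x X⊆H b             ∎)
      where
      open SetoidReasoning (Val.setoid X)
      X⊆H : ⟪ X ⟫ ⊆ ⟪ H ⟫
      X⊆H z∈ = V⊆H (X⊆V z∈)

    ∼-injective : ∀ {U} (u : U ∈ 𝒰) {a b : Elt U} → germ u a ∼ germ u b → a ≈ b
    ∼-injective u p = ρ-∼-injective u u id id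
      -- Restriction from U to itself is the identity only up to `≈`, so it is inserted on both
      -- sides first.
      (∼-trans (∼-sym (∼-ρ u u id _)) (∼-trans p (∼-ρ u u id _)))

module _ {ℓ} {m : Level} {G : TopologicalGroup ℓ} {𝔐 : MackeySystem G} (𝔘 : DescentBasis 𝔐)
         (fin : IFinite (MackeySystem.subgroupSystem 𝔐)) where
  open MackeySystem 𝔐
  open DescentBasis 𝔘
  private
    module G = TopologicalGroup G

  -- Restriction is the inclusion and `con` followed by `cast` is the action on A, so an H-invariant
  -- element of A^U is literally an element of A^H.
  fixedPoints-hasGaloisDescent : (A : DiscreteModule m G) → HasGaloisDescent 𝔘 (_⁎ 𝔐 fin A)
  fixedPoints-hasGaloisDescent A {H} {U} u U⊆H = record
    { isGroupMonomorphism = record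
      { isGroupHomomorphism = GroupHomomorphism.isGroupHomomorphism
          (mkHom {A = fixedPoints A (proj₁ H)} {B = invariants {H} {U} u U⊆H}
            (resInvariants {H} {U} u U⊆H) id (λ _ _ → A.refl))
      ; injective = id
      }
    ; surjective = λ ((a , _) , a-invariant) → (a , a-invariant) , id
    }
    where
    open Colimit 𝔘 (_⁎ 𝔐 fin A)
    module A = DiscreteModule A

  counit-iso : (A : DiscreteModule m G) → IsUnionOfFixedPoints 𝔘 A → IsIso (Mod m G) (counit 𝔘 fin A)
  counit-iso A A-union = bijective⇒module-iso {A = Colimit.colimitModule 𝔘 (_⁎ 𝔐 fin A)} {B = A} (counit 𝔘 fin A)
    (λ {x} {y} p →
      -- Restrictions keep the underlying element of A, so equality in A is agreement at any common
      -- stage.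
      let (W , w , W⊆) = 𝒰-filtered (stage∈ x) (stage∈ y)
      in agree w (λ z∈ → proj₁ (W⊆ z∈)) (λ z∈ → proj₂ (W⊆ z∈)) p)
    (λ a →
      let (U , u , a-fixed) = A-union a
      in germ u (a , a-fixed) , DiscreteModule.refl A)
    where open Colimit 𝔘 (_⁎ 𝔐 fin A)

  module _ (Φ : MackeyFunctor m 𝔐) (descent : HasGaloisDescent 𝔘 Φ) where
    open MackeyFunctor Φ
    open MackeyFunctorProperties Φ
    open Colimit 𝔘 Φ
    open Unit 𝔘 fin Φ
    private
      module Val H = AbelianGroup (val H)
      module Descent {H U} (u : U ∈ 𝒰) (U⊆H : ⟪ U ⟫ ⊆ ⟪ H ⟫) =
        GroupMorphisms.IsGroupIsomorphism (descent {H} {U} u U⊆H)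

    η-surjective : ∀ H x → FixedBy colimitModule (proj₁ H) x → ∃ λ a → η H a ∼ x
    η-surjective H x@(germ {V} v b) x-fixed =
      -- The stage V need not lie in H; refining it to W ≤ U ∩ V makes descent along W ≤ H
      -- available.
      let (U , u , U⊆H) = 𝒰-below H
          (W , w , W⊆)  = 𝒰-filtered u v
          W⊆H : ⟪ W ⟫ ⊆ ⟪ H ⟫
          W⊆H = λ z∈ → U⊆H (proj₁ (W⊆ z∈))
          c : Elt W
          c = ρ w (λ z∈ → proj₂ (W⊆ z∈)) b
          x∼c : x ∼ germ w c
          x∼c = ∼-ρ v w (λ z∈ → proj₂ (W⊆ z∈)) b
          c-invariant : ∀ h → h ∈ ⟪ H ⟫ → act {W} (𝒰-normal w) h c ≈ c
          -- By definition h acts on [W,c] through c, so invariance of the germ is an equality of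
          -- two germs at stage W, which descent turns into an equality in Φ(W).
          c-invariant = λ h h∈ → ∼-injective 𝔘 Φ descent w
            (∼-trans (▹-cong G.refl (∼-sym x∼c)) (∼-trans (x-fixed h h∈) x∼c))
          (a , a↦c) = Descent.surjective {H} {W} w W⊆H (c , c-invariant)
      in a , ∼-trans (η-any {H} {W} w W⊆H a) (∼-trans (same-stage w (a↦c (Val.refl H))) (∼-sym x∼c))

    unit-iso : IsIso (Mack m 𝔐) (Unit.unit 𝔘 fin Φ)
    unit-iso = bijective⇒mackey-iso {Φ = Φ} {Ψ = _⁎ 𝔐 fin (Colimit.colimitModule 𝔘 Φ)} (Unit.unit 𝔘 fin Φ)
      (λ H → ρ-∼-injective 𝔘 Φ descent {H} _ _ _ _)
      (λ H (x , x-fixed) → η-surjective H x x-fixed)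

proposition2p3p21 : ∀ {ℓ} (m : Level) (G : TopologicalGroup ℓ) (𝔐 : MackeySystem G)
    (I-finite : IFinite (MackeySystem.subgroupSystem 𝔐)) (𝔘 : DescentBasis 𝔐) →
    InducesEquivalence (adjunction {m = m} 𝔘 I-finite) (IsUnionOfFixedPoints 𝔘) (HasGaloisDescent 𝔘)
    × (IsNeighbourhoodBasis 𝔘 → InducesEquivalenceˡ (adjunction {m = m} 𝔘 I-finite) (HasGaloisDescent 𝔘))
proposition2p3p21 m G 𝔐 I-finite 𝔘 =
  ( (λ Φ _ → colimit-isUnionOfFixedPoints 𝔘 Φ)
  , (λ A _ → fixedPoints-hasGaloisDescent 𝔘 I-finite A)
  , (λ (Φ , descent) → fullSubcategory-iso (Mack m 𝔐) (unit-iso 𝔘 I-finite Φ descent))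
  , (λ (A , A-union) → fullSubcategory-iso (Mod m G) (counit-iso 𝔘 I-finite A A-union)) )
  -- Now every discrete module is a union of fixed points, so the counit is invertible on the whole
  -- category.
  , λ basis →
    fixedPoints-hasGaloisDescent 𝔘 I-finite
  , (λ (Φ , descent) → fullSubcategory-iso (Mack m 𝔐) (unit-iso 𝔘 I-finite Φ descent))
  , (λ A → counit-iso 𝔘 I-finite A (neighbourhoodBasis⇒isUnionOfFixedPoints 𝔘 basis A))
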